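{- For all integers $n\ge 0$, $$F(2n;0,n)=4^n\frac{(3/2)_n}{(2n+1)(2)_n}=\frac{4^n(1/2)_n}{(2)_n},$$ $$F(2n+2;0,n)=\frac{2^{2n+1}(n+1)(3/2)_n}{(3)_n},$$ $$F(2n+4;0,n)=\frac{4^n(n+1)(8n^2+32n+33)(3/2)_n}{3\,(4)_n},$$ $$F(2n+6;0,n)=\frac{4^{n-1}(n+1)(64n^4+672n^3+2648n^2+4641n+3060)(3/2)_n}{9\,(5)_n}.$$ More generally, for every integer $k\ge 0$ there is a function $r_k(n)$ such that for all integers $n\ge 0$ $$F(2n+2k;0,n)=4^n\frac{(3/2)_n}{(k+2)_n}\,r_k(n),$$ where $r_0(n)=\frac{1}{2n+1}$ and, for $k\ge 1$, $r_k(n)$ is a polynomial in $n$ of degree $2k-1$ divisible by $n+1$.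
   Context: For integers $m\ge 0$ and $n_1,n_2$, $F(m;n_1,n_2)$ denotes the number of Gessel walks with exactly $m$ steps from $(0,0)$ to $(n_1,n_2)$: lattice walks starting at the origin, each of whose $m$ steps is one of West $(-1,0)$, North-East $(1,1)$, East $(1,0)$, South-West $(-1,-1)$, and which remain in the first quadrant $\{(i,j): i\ge 0, j\ge 0\}$. In particular $F(m;n_1,n_2)=0$ if $n_1<0$ or $n_2<0$, and $F(0;n_1,n_2)=1$ if $n_1=n_2=0$ and $0$ otherwise. $(a)_n=a(a+1)\cdots(a+n-1)$ is the Pochhammer symbol, with $(a)_0=1$. -}

module Defs where

open import Data.Nat as ℕ using (ℕ; zero; suc)
open import Data.Integer as ℤ using (ℤ; +_)
open import Data.Rational using (ℚ; 0ℚ; 1ℚ; _+_; _*_; _/_; _÷_; NonZero; Positive)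
open import Data.Rational.Properties
open import Data.List using (List; []; _∷_; map; filter; length; cartesianProductWith)
open import Data.Vec using (Vec; []; _∷_)
open import Data.Product using (_×_; _,_; ∃-syntax)
open import Data.Product.Properties using (≡-dec)
open import Relation.Nullary using (Dec)
open import Relation.Nullary.Decidable using (_×-dec_)
open import Relation.Binary.PropositionalEquality using (_≡_; _≢_)

Point : Set
Point = ℤ × ℤ

data Step : Set where
  W NE E SW : Step

move : Step → Point → Point
move W  (i , j) = ℤ.pred i , j
move NE (i , j) = ℤ.suc i  , ℤ.suc j
move E  (i , j) = ℤ.suc i  , j
move SW (i , j) = ℤ.pred i , ℤ.pred j

InQuadrant : Point → Set
InQuadrant (i , j) = (+ 0 ℤ.≤ i) × (+ 0 ℤ.≤ j)

inQuadrant? : ∀ p → Dec (InQuadrant p)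
inQuadrant? (i , j) = (+ 0 ℤ.≤? i) ×-dec (+ 0 ℤ.≤? j)

endpoint : ∀ {m} → Point → Vec Step m → Point
endpoint p []      = p
endpoint p (s ∷ w) = endpoint (move s p) w

-- Every point visited, including the starting point p, lies in the quadrant.
Stays : ∀ {m} → Point → Vec Step m → Set
Stays p []      = InQuadrant p
Stays p (s ∷ w) = InQuadrant p × Stays (move s p) w

stays? : ∀ {m} p (w : Vec Step m) → Dec (Stays p w)
stays? p []      = inQuadrant? p
stays? p (s ∷ w) = inQuadrant? p ×-dec stays? (move s p) w

origin : Point
origin = + 0 , + 0

IsGesselWalkTo : ∀ {m} → Point → Vec Step m → Set
IsGesselWalkTo p w = Stays origin w × endpoint origin w ≡ p

isGesselWalkTo? : ∀ {m} p (w : Vec Step m) → Dec (IsGesselWalkTo p w)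
isGesselWalkTo? p w = stays? origin w ×-dec ≡-dec ℤ._≟_ ℤ._≟_ (endpoint origin w) p

-- All 4ᵐ step sequences of length m, each listed exactly once.
words : ∀ m → List (Vec Step m)
words zero    = [] ∷ []
words (suc m) = cartesianProductWith _∷_ (W ∷ NE ∷ E ∷ SW ∷ []) (words m)

F : ℕ → ℤ → ℤ → ℕ
F m n₁ n₂ = length (filter (isGesselWalkTo? (n₁ , n₂)) (words m))

fromℕ : ℕ → ℚ
fromℕ n = + n / 1

-- The Pochhammer symbol (a)ₙ
poch : ℚ → ℕ → ℚ
poch a zero    = 1ℚ
poch a (suc n) = poch a n * (a + fromℕ n)

poch-pos : ∀ a n → .{{Positive a}} → Positive (poch a n)
poch-pos a zero    = _
poch-pos a (suc n) =
  pos*pos⇒pos (poch a n) {{poch-pos a n}} (a + fromℕ n)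
    {{pos+nonNeg⇒pos a (fromℕ n) {{normalize-nonNeg n 1}}}}

infixl 7 _÷⟨_⟩_

-- x ÷⟨ a ⟩ n = x / (a)ₙ for a positive integer a
_÷⟨_⟩_ : ℚ → (a : ℕ) → .{{ℕ.NonZero a}} → ℕ → ℚ
x ÷⟨ a ⟩ n = (x ÷ poch (fromℕ a) n) {{poch-nonZero}}
  where
  poch-nonZero : NonZero (poch (fromℕ a) n)
  poch-nonZero =
    pos⇒nonZero (poch (fromℕ a) n) {{poch-pos (fromℕ a) n {{normalize-pos a 1}}}}

-- Polynomials in one variable over ℚ: lists of coefficients, constant term
-- first. Trailing zeros are allowed, so equality is ≈ₚ rather than ≡.

Poly : Set
Poly = List ℚ

coeff : Poly → ℕ → ℚ
coeff []      _       = 0ℚ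
coeff (a ∷ p) zero    = a
coeff (a ∷ p) (suc i) = coeff p i

infix 4 _≈ₚ_ _∣ₚ_
infixl 6 _+ₚ_
infixl 7 _*ₚ_

_≈ₚ_ : Poly → Poly → Set
p ≈ₚ q = ∀ i → coeff p i ≡ coeff q i

_+ₚ_ : Poly → Poly → Poly
[]      +ₚ q       = q
(a ∷ p) +ₚ []      = a ∷ p
(a ∷ p) +ₚ (b ∷ q) = (a + b) ∷ (p +ₚ q)

_*ₚ_ : Poly → Poly → Poly
[]      *ₚ q = []
(a ∷ p) *ₚ q = map (a *_) q +ₚ (0ℚ ∷ p *ₚ q)

_∣ₚ_ : Poly → Poly → Set
p ∣ₚ q = ∃[ r ] q ≈ₚ p *ₚ r

eval : Poly → ℚ → ℚ
eval []      x = 0ℚ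
eval (a ∷ p) x = a + x * eval p x

HasDegree : Poly → ℕ → Set
HasDegree p d = coeff p d ≢ 0ℚ × (∀ i → d ℕ.< i → coeff p i ≡ 0ℚ)

X+1 : Poly
X+1 = 1ℚ ∷ 1ℚ ∷ []

{-# OPTIONS --safe #-}

-- A walk of 2n + 2k steps from the origin to (0 , n) contains exactly k steps E or
-- SW. Dropping the condition j ≥ 0, such walks are counted by a ballot number times
-- a binomial coefficient. A walk that violates j ≥ 0 first does so by a SW step from
-- (h + 1 , 0) to (h , -1); at that moment some number q ≤ k - 2 of E and SW steps
-- remain, and the possible beginnings form a finite list independent of n. Hence
-- F is one hypergeometric term minus a fixed finite sum of such terms, and each is
-- 4ⁿ (3/2)ₙ / (k + 2)ₙ times a polynomial in n: of degree 2k - 1 for the main term,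
-- of smaller degree for the others. All of this remains true for n = -1, where the
-- count is 0, so the polynomial vanishes at -1.

module Submission where

open import Defs

-- The endpoints and the length of a walk determine how many of its steps are E or SW. So after a
-- first exit at (h, -1) with q such steps still to come, exactly 2 (n + 1) + 2 q + h steps are
-- left, never fewer than 2 n + 2. Every exit thus falls within the first 2 k - 2 steps, whatever n
-- is; this makes the list of beginnings finite and independent of n. The walks that follow such an
-- exit are counted by a fraction with (n + q + h + 2)! in its denominator, which must divide the
-- common (n + k + 1)! for the quotient to be a polynomial. It does: if x is the number of E and SW
-- steps to come, x + i - j starts at k, never increases, and drops by one in the SW step that
-- leaves the quadrant, so q + h + 1 is at most k - 1. Over the common denominator the term of a
-- beginning has q + k - 1 factors linear in n, the main term 2 k - 1. The index s = n + 1 is used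
-- throughout so that n = -1 becomes the natural number s = 0.

module FirstPassage where

  open import Data.Nat using (ℕ; zero; suc; _+_; _*_; _≤_; _<_; s≤s)
  open import Data.Nat.Combinatorics using (_C_; nCk+nC[k+1]≡[n+1]C[k+1])
  open import Data.Nat.ListAction using (sum)
  open import Data.Nat.ListAction.Properties using (sum-++)
  open import Data.Nat.Properties
  open import Data.Nat.Tactic.RingSolver using (solve; solve-∀)
  open import Data.List using (List; []; _∷_; map; _++_)
  open import Data.List.Properties using (map-++)
  open import Data.List.Relation.Unary.All as All using (All)
  open import Data.List.Relation.Unary.All.Properties using (++⁺)
  open import Data.Product using (_×_; _,_)
  open import Relation.Nullary using (contradiction)
  open import Relation.Binary.PropositionalEquality

  -- Half-plane walks, quadrant walks and the first exit.

  ballot : ℕ → ℕ → ℕ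
  ballot zero    zero    = 1
  ballot zero    (suc _) = 0
  ballot (suc m) zero    = ballot m 1
  ballot (suc m) (suc i) = ballot m i + ballot m (suc (suc i))

  -- Walks of m steps from column i to column 0 in the half plane i ≥ 0, of which
  -- exactly x are E or SW: a step is a direction ±1 (NE, E or W, SW) together with
  -- a free bit telling whether it is one of these x.
  halfPlane : ℕ → ℕ → ℕ → ℕ
  halfPlane m i x = ballot m i * (m C x)

  δ : ℕ → ℕ → ℕ
  δ zero    zero    = 1
  δ zero    (suc _) = 0
  δ (suc _) zero    = 0
  δ (suc m) (suc n) = δ m n

  -- Quadrant walks of m steps from (i , j) to (0 , s - 1); for s = 0 there are none.
  quadrant : ℕ → ℕ → ℕ → ℕ → ℕ
  quadrant s zero    zero    j       = δ (suc j) s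
  quadrant s zero    (suc _) j       = 0
  quadrant s (suc m) zero    j       = quadrant s m 1 (suc j) + quadrant s m 1 j
  quadrant s (suc m) (suc i) zero    =
    quadrant s m i 0 + (quadrant s m (2 + i) 1 + quadrant s m (2 + i) 0)
  quadrant s (suc m) (suc i) (suc j) =
    quadrant s m i (suc j) + (quadrant s m (2 + i) (2 + j) + (quadrant s m (2 + i) (suc j) + quadrant s m i j))

  -- One entry (q , h) for each walk from (i , j) that leaves the quadrant only with
  -- its last step, SW to (h , -1), when x steps E or SW are available at the start
  -- and q remain at the end. On the way to (0 , s - 1) this is impossible once at
  -- most 2 * s steps are left; e counts the steps in excess of that number, which
  -- makes the list independent of s.
  hits : ℕ → ℕ → ℕ → ℕ → List (ℕ × ℕ)
  hits e       i       j       zero    = []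
  hits zero    i       j       (suc x) = []
  hits (suc e) zero    j       (suc x) = hits e 1 (suc j) (suc x) ++ hits e 1 j x
  hits (suc e) (suc i) zero    (suc x) =
    hits e i 0 (suc x) ++ (hits e (2 + i) 1 (suc x) ++ (hits e (2 + i) 0 x ++ (x , i) ∷ []))
  hits (suc e) (suc i) (suc j) (suc x) =
    hits e i (suc j) (suc x) ++ (hits e (2 + i) (2 + j) (suc x) ++ (hits e (2 + i) (suc j) x ++ hits e i j x))

  afterHit : ℕ → ℕ × ℕ → ℕ
  afterHit s (q , i) = halfPlane (2 * (s + q) + i) i q

  total : ℕ → List (ℕ × ℕ) → ℕ
  total s hs = sum (map (afterHit s) hs)

  total-++ : ∀ s xs ys → total s (xs ++ ys) ≡ total s xs + total s ys
  total-++ s xs ys = trans (cong sum (map-++ (afterHit s) xs ys)) (sum-++ (map (afterHit s) xs) _)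

  total-++₄ : ∀ s ws xs ys zs →
    total s (ws ++ (xs ++ (ys ++ zs))) ≡ total s ws + (total s xs + (total s ys + total s zs))
  total-++₄ s ws xs ys zs =
    trans (total-++ s ws _) (cong (total s ws +_)
      (trans (total-++ s xs _) (cong (total s xs +_) (total-++ s ys zs))))

  -- Holds between (i , j) and the target (0 , s - 1), which fixes the number x of
  -- E and SW steps of a walk of m steps joining them.
  Balance : (s m i j x : ℕ) → Set
  Balance s m i j x = m + 2 * suc j ≡ 2 * s + (2 * x + i)

  -- The same relation when that number would be the negative -(x + 1).
  Deficit : (s m i j x : ℕ) → Set
  Deficit s m i j x = m + 2 * suc j + 2 * suc x ≡ 2 * s + i

  -- Taking a step changes both sides of an equation by the same integer; `c` and `d` express that
  -- integer without subtraction, and only linear identities remain for the solver.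
  shift : ∀ c d {a b a′ b′} → c + a′ ≡ d + a → c + b′ ≡ d + b → a ≡ b → a′ ≡ b′
  shift c d p q r = +-cancelˡ-≡ c _ _ (trans p (trans (cong (d +_) r) (sym q)))

  balance-W : ∀ s m i j x → Balance s (suc m) (suc i) j x → Balance s m i j x
  balance-W s m i j x = shift 1 0 refl (solve (s ∷ i ∷ x ∷ []))

  balance-NE : ∀ s m i j x → Balance s (suc m) i j x → Balance s m (suc i) (suc j) x
  balance-NE s m i j x = shift 0 1 (solve (m ∷ j ∷ [])) (solve (s ∷ i ∷ x ∷ []))

  balance-E : ∀ s m i j x → Balance s (suc m) i j (suc x) → Balance s m (suc i) j x
  balance-E s m i j x = shift 1 0 refl (solve (s ∷ i ∷ x ∷ []))

  balance-SW : ∀ s m i j x → Balance s (suc m) (suc i) (suc j) (suc x) → Balance s m i j x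
  balance-SW s m i j x = shift 3 0 (solve (m ∷ j ∷ [])) (solve (s ∷ i ∷ x ∷ []))

  δ-refl : ∀ n → δ n n ≡ 1
  δ-refl zero    = refl
  δ-refl (suc n) = δ-refl n

  δ-+ʳ : ∀ m n → δ m (m + suc n) ≡ 0
  δ-+ʳ zero    n = refl
  δ-+ʳ (suc m) n = δ-+ʳ m n

  δ-+ˡ : ∀ m n → δ (m + suc n) m ≡ 0
  δ-+ˡ zero    n = refl
  δ-+ˡ (suc m) n = δ-+ˡ m n

  deficit-W : ∀ s m i j x → Deficit s (suc m) (suc i) j x → Deficit s m i j x
  deficit-W s m i j x = shift 1 0 refl (solve (s ∷ i ∷ []))

  deficit-NE : ∀ s m i j x → Deficit s (suc m) i j x → Deficit s m (suc i) (suc j) x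
  deficit-NE s m i j x = shift 0 1 (solve (m ∷ j ∷ x ∷ [])) (solve (s ∷ i ∷ []))

  deficit-E : ∀ s m i j x → Deficit s (suc m) i j x → Deficit s m (suc i) j (suc x)
  deficit-E s m i j x = shift 0 1 (solve (m ∷ j ∷ x ∷ [])) (solve (s ∷ i ∷ []))

  deficit-SW : ∀ s m i j x → Deficit s (suc m) (suc i) (suc j) x → Deficit s m i j (suc x)
  deficit-SW s m i j x = shift 1 0 (solve (m ∷ j ∷ x ∷ [])) (solve (s ∷ i ∷ []))

  -- W and NE preserve the number of E and SW steps still required, E and SW lower it by one. Once
  -- negative it stays negative, while stopping on the target needs it to be 0.
  quadrant-deficit : ∀ s m i j x → Deficit s m i j x → quadrant s m i j ≡ 0
  quadrant-deficit s zero zero j x eq = trans (cong (δ (suc j)) s≡) (δ-+ʳ (suc j) x)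
    where
    s≡ : s ≡ suc j + suc x
    s≡ = *-cancelˡ-≡ _ _ 2 (trans (sym (trans eq (+-identityʳ _))) (sym (*-distribˡ-+ 2 (suc j) (suc x))))
  quadrant-deficit s zero (suc i) j x eq = refl
  quadrant-deficit s (suc m) zero j x eq =
    cong₂ _+_ (quadrant-deficit s m 1 (suc j) x (deficit-NE s m 0 j x eq))
      (quadrant-deficit s m 1 j (suc x) (deficit-E s m 0 j x eq))
  quadrant-deficit s (suc m) (suc i) zero x eq =
    cong₂ _+_ (quadrant-deficit s m i 0 x (deficit-W s m i 0 x eq))
      (cong₂ _+_ (quadrant-deficit s m (2 + i) 1 x (deficit-NE s m (suc i) 0 x eq))
        (quadrant-deficit s m (2 + i) 0 (suc x) (deficit-E s m (suc i) 0 x eq)))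
  quadrant-deficit s (suc m) (suc i) (suc j) x eq =
    cong₂ _+_ (quadrant-deficit s m i (suc j) x (deficit-W s m i (suc j) x eq))
      (cong₂ _+_ (quadrant-deficit s m (2 + i) (2 + j) x (deficit-NE s m (suc i) (suc j) x eq))
        (cong₂ _+_ (quadrant-deficit s m (2 + i) (suc j) (suc x) (deficit-E s m (suc i) (suc j) x eq))
          (quadrant-deficit s m i j (suc x) (deficit-SW s m i j x eq))))

  balance⇒deficit-E : ∀ s m i j → Balance s (suc m) i j 0 → Deficit s m (suc i) j 0
  balance⇒deficit-E s m i j = shift 0 1 (solve (m ∷ j ∷ [])) (solve (s ∷ i ∷ []))

  balance⇒deficit-SW : ∀ s m i j → Balance s (suc m) (suc i) (suc j) 0 → Deficit s m i j 0
  balance⇒deficit-SW s m i j = shift 1 0 (solve (m ∷ j ∷ [])) (solve (s ∷ i ∷ []))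

  balance-stop : ∀ s j x → Balance s 0 0 j x → suc j ≡ s + x
  balance-stop s j x eq =
    *-cancelˡ-≡ _ _ 2 (trans eq (trans (cong (2 * s +_) (+-identityʳ _)) (sym (*-distribˡ-+ 2 s x))))

  -- This is the count of steps left after the exit to (i, -1). Being at least `2 * s`, it justifies
  -- that `hits` stops when `e` reaches zero.
  balance-hit : ∀ s m i x → Balance s (suc m) (suc i) 0 (suc x) → m ≡ 2 * s + (2 * x + i)
  balance-hit s m i x = shift 3 0 (solve (m ∷ [])) (solve (s ∷ i ∷ x ∷ []))

  halfPlane-zero : ∀ m i → halfPlane m i 0 ≡ ballot m i
  halfPlane-zero m i = *-identityʳ (ballot m i)

  C-pascal : ∀ m x → suc m C suc x ≡ m C suc x + m C x
  C-pascal m x = trans (sym (nCk+nC[k+1]≡[n+1]C[k+1] m x)) (+-comm (m C x) _)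

  halfPlane-suc : ∀ m x → halfPlane (suc m) 0 (suc x) ≡ halfPlane m 1 (suc x) + halfPlane m 1 x
  halfPlane-suc m x = trans (cong (ballot m 1 *_) (C-pascal m x)) (*-distribˡ-+ (ballot m 1) _ _)

  -- The direction and the bit are independent, so the product of the two recursions has one term
  -- for each of W, NE, E, SW, in the order used by `quadrant`.
  halfPlane-suc-suc : ∀ m i x → halfPlane (suc m) (suc i) (suc x) ≡
    halfPlane m i (suc x) + (halfPlane m (2 + i) (suc x) + (halfPlane m (2 + i) x + halfPlane m i x))
  halfPlane-suc-suc m i x = trans (cong ((b + b′) *_) (C-pascal m x)) (expand b b′ c c′)
    where
    b = ballot m i
    b′ = ballot m (2 + i)
    c = m C suc x
    c′ = m C x
    expand : ∀ b b′ c c′ → (b + b′) * (c + c′) ≡ b * c + (b′ * c + (b′ * c′ + b * c′))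
    expand = solve-∀

  -- Without E and SW steps to spend, j cannot decrease and the condition j ≥ 0 is automatic. The E
  -- and SW branches of `quadrant` are present but zero, by the deficit they create.
  ballot≡quadrant : ∀ s m i j → Balance s m i j 0 → ballot m i ≡ quadrant s m i j
  ballot≡quadrant s zero zero j eq =
    sym (trans (cong (λ t → δ t s) (trans (balance-stop s j 0 eq) (+-identityʳ s))) (δ-refl s))
  ballot≡quadrant s zero (suc i) j eq = refl
  ballot≡quadrant s (suc m) zero j eq =
    trans (sym (+-identityʳ _))
      (cong₂ _+_ (ballot≡quadrant s m 1 (suc j) (balance-NE s m 0 j 0 eq))
        (sym (quadrant-deficit s m 1 j 0 (balance⇒deficit-E s m 0 j eq))))
  ballot≡quadrant s (suc m) (suc i) zero eq =
    cong₂ _+_ (ballot≡quadrant s m i 0 (balance-W s m i 0 0 eq))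
      (trans (sym (+-identityʳ _))
        (cong₂ _+_ (ballot≡quadrant s m (2 + i) 1 (balance-NE s m (suc i) 0 0 eq))
          (sym (quadrant-deficit s m (2 + i) 0 0 (balance⇒deficit-E s m (suc i) 0 eq)))))
  ballot≡quadrant s (suc m) (suc i) (suc j) eq =
    cong₂ _+_ (ballot≡quadrant s m i (suc j) (balance-W s m i (suc j) 0 eq))
      (trans (sym (+-identityʳ _))
        (cong₂ _+_ (ballot≡quadrant s m (2 + i) (2 + j) (balance-NE s m (suc i) (suc j) 0 eq))
          (sym (cong₂ _+_
            (quadrant-deficit s m (2 + i) (suc j) 0 (balance⇒deficit-E s m (suc i) (suc j) eq))
            (quadrant-deficit s m i j 0 (balance⇒deficit-SW s m i j eq))))))

  -- An exit would leave at least `2 * s` steps after it, hence needs more than `2 * s` before it.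
  -- So the edge j = 0 with i > 0 and an E or SW step to spend contradicts the balance.
  halfPlane≡quadrant : ∀ s m i j x → m ≤ 2 * s → Balance s m i j x → halfPlane m i x ≡ quadrant s m i j
  halfPlane≡quadrant s m i j zero m≤ eq = trans (halfPlane-zero m i) (ballot≡quadrant s m i j eq)
  halfPlane≡quadrant s zero zero j (suc x) m≤ eq =
    sym (trans (cong (λ t → δ t s) (balance-stop s j (suc x) eq)) (δ-+ˡ s x))
  halfPlane≡quadrant s zero (suc i) j (suc x) m≤ eq = refl
  halfPlane≡quadrant s (suc m) zero j (suc x) m<2s eq =
    trans (halfPlane-suc m x)
      (cong₂ _+_ (halfPlane≡quadrant s m 1 (suc j) (suc x) m≤2s (balance-NE s m 0 j (suc x) eq))
        (halfPlane≡quadrant s m 1 j x m≤2s (balance-E s m 0 j x eq)))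
    where m≤2s = <⇒≤ m<2s
  halfPlane≡quadrant s (suc m) (suc i) zero (suc x) m<2s eq =
    contradiction m<2s (<⇒≱ (s≤s (≤-trans (m≤m+n (2 * s) _) (≤-reflexive (sym m≡)))))
    where
    m≡ : m ≡ 2 * s + (2 * x + i)
    m≡ = balance-hit s m i x eq
  halfPlane≡quadrant s (suc m) (suc i) (suc j) (suc x) m<2s eq =
    trans (halfPlane-suc-suc m i x)
      (cong₂ _+_ (halfPlane≡quadrant s m i (suc j) (suc x) m≤2s (balance-W s m i (suc j) (suc x) eq))
        (cong₂ _+_ (halfPlane≡quadrant s m (2 + i) (2 + j) (suc x) m≤2s (balance-NE s m (suc i) (suc j) (suc x) eq))
          (cong₂ _+_ (halfPlane≡quadrant s m (2 + i) (suc j) x m≤2s (balance-E s m (suc i) (suc j) x eq))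
            (halfPlane≡quadrant s m i j x m≤2s (balance-SW s m i j x eq)))))
    where m≤2s = <⇒≤ m<2s

  -- Both counts obey the same recursion on the first step, except for SW at j = 0: there the
  -- half-plane branch has no partner in `quadrant`, and it is exactly the `afterHit` of the entry
  -- that `hits` adds.
  first-passage : ∀ s e i j x → Balance s (e + 2 * s) i j x →
    halfPlane (e + 2 * s) i x ≡ quadrant s (e + 2 * s) i j + total s (hits e i j x)
  first-passage s e i j zero eq =
    trans (halfPlane-zero (e + 2 * s) i) (trans (ballot≡quadrant s (e + 2 * s) i j eq) (sym (+-identityʳ _)))
  first-passage s zero i j (suc x) eq =
    trans (halfPlane≡quadrant s (2 * s) i j (suc x) ≤-refl eq) (sym (+-identityʳ _))
  first-passage s (suc e) zero j (suc x) eq = begin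
    halfPlane (suc m) 0 (suc x)
      ≡⟨ halfPlane-suc m x ⟩
    halfPlane m 1 (suc x) + halfPlane m 1 x
      ≡⟨ cong₂ _+_ (first-passage s e 1 (suc j) (suc x) (balance-NE s m 0 j (suc x) eq))
          (first-passage s e 1 j x (balance-E s m 0 j x eq)) ⟩
    (q₁ + total s h₁) + (q₂ + total s h₂)
      ≡⟨ interchange q₁ q₂ (total s h₁) (total s h₂) ⟩
    (q₁ + q₂) + (total s h₁ + total s h₂)
      ≡⟨ cong ((q₁ + q₂) +_) (total-++ s h₁ h₂) ⟨
    (q₁ + q₂) + total s (h₁ ++ h₂) ∎
    where
    open ≡-Reasoning
    m = e + 2 * s
    q₁ = quadrant s m 1 (suc j)
    q₂ = quadrant s m 1 j
    h₁ = hits e 1 (suc j) (suc x)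
    h₂ = hits e 1 j x
    interchange : ∀ a b c d → (a + c) + (b + d) ≡ (a + b) + (c + d)
    interchange = solve-∀
  first-passage s (suc e) (suc i) zero (suc x) eq = begin
    halfPlane (suc m) (suc i) (suc x)
      ≡⟨ halfPlane-suc-suc m i x ⟩
    halfPlane m i (suc x) + (halfPlane m (2 + i) (suc x) + (halfPlane m (2 + i) x + halfPlane m i x))
      ≡⟨ cong₂ _+_ (first-passage s e i 0 (suc x) (balance-W s m i 0 (suc x) eq))
          (cong₂ _+_ (first-passage s e (2 + i) 1 (suc x) (balance-NE s m (suc i) 0 (suc x) eq))
            (cong₂ _+_ (first-passage s e (2 + i) 0 x (balance-E s m (suc i) 0 x eq))
              (trans (cong (λ t → halfPlane t i x) m≡) (sym (+-identityʳ _))))) ⟩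
    (q₁ + total s h₁) + ((q₂ + total s h₂) + ((q₃ + total s h₃) + total s ((x , i) ∷ [])))
      ≡⟨ interchange q₁ q₂ q₃ (total s h₁) (total s h₂) (total s h₃) (total s ((x , i) ∷ [])) ⟩
    (q₁ + (q₂ + q₃)) + (total s h₁ + (total s h₂ + (total s h₃ + total s ((x , i) ∷ []))))
      ≡⟨ cong ((q₁ + (q₂ + q₃)) +_) (total-++₄ s h₁ h₂ h₃ ((x , i) ∷ [])) ⟨
    (q₁ + (q₂ + q₃)) + total s (h₁ ++ (h₂ ++ (h₃ ++ (x , i) ∷ []))) ∎
    where
    open ≡-Reasoning
    m = e + 2 * s
    q₁ = quadrant s m i 0
    q₂ = quadrant s m (2 + i) 1
    q₃ = quadrant s m (2 + i) 0
    h₁ = hits e i 0 (suc x)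
    h₂ = hits e (2 + i) 1 (suc x)
    h₃ = hits e (2 + i) 0 x
    m≡ : m ≡ 2 * (s + x) + i
    m≡ = trans (balance-hit s m i x eq) (solve (s ∷ x ∷ i ∷ []))
    interchange : ∀ a b c a′ b′ c′ d →
      (a + a′) + ((b + b′) + ((c + c′) + d)) ≡ (a + (b + c)) + (a′ + (b′ + (c′ + d)))
    interchange = solve-∀
  first-passage s (suc e) (suc i) (suc j) (suc x) eq = begin
    halfPlane (suc m) (suc i) (suc x)
      ≡⟨ halfPlane-suc-suc m i x ⟩
    halfPlane m i (suc x) + (halfPlane m (2 + i) (suc x) + (halfPlane m (2 + i) x + halfPlane m i x))
      ≡⟨ cong₂ _+_ (first-passage s e i (suc j) (suc x) (balance-W s m i (suc j) (suc x) eq))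
          (cong₂ _+_ (first-passage s e (2 + i) (2 + j) (suc x) (balance-NE s m (suc i) (suc j) (suc x) eq))
            (cong₂ _+_ (first-passage s e (2 + i) (suc j) x (balance-E s m (suc i) (suc j) x eq))
              (first-passage s e i j x (balance-SW s m i j x eq)))) ⟩
    (q₁ + total s h₁) + ((q₂ + total s h₂) + ((q₃ + total s h₃) + (q₄ + total s h₄)))
      ≡⟨ interchange q₁ q₂ q₃ q₄ (total s h₁) (total s h₂) (total s h₃) (total s h₄) ⟩
    (q₁ + (q₂ + (q₃ + q₄))) + (total s h₁ + (total s h₂ + (total s h₃ + total s h₄)))
      ≡⟨ cong ((q₁ + (q₂ + (q₃ + q₄))) +_) (total-++₄ s h₁ h₂ h₃ h₄) ⟨
    (q₁ + (q₂ + (q₃ + q₄))) + total s (h₁ ++ (h₂ ++ (h₃ ++ h₄))) ∎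
    where
    open ≡-Reasoning
    m = e + 2 * s
    q₁ = quadrant s m i (suc j)
    q₂ = quadrant s m (2 + i) (2 + j)
    q₃ = quadrant s m (2 + i) (suc j)
    q₄ = quadrant s m i j
    h₁ = hits e i (suc j) (suc x)
    h₂ = hits e (2 + i) (2 + j) (suc x)
    h₃ = hits e (2 + i) (suc j) x
    h₄ = hits e i j x
    interchange : ∀ a b c d a′ b′ c′ d′ →
      (a + a′) + ((b + b′) + ((c + c′) + (d + d′))) ≡ (a + (b + (c + d))) + (a′ + (b′ + (c′ + d′)))
    interchange = solve-∀

  -- NE and E preserve x + i - j, W and SW lower it by one. At (h, -1) its value is q + h + 1, and
  -- the SW step leading there has cost one more.
  Bounded : ℕ → ℕ → ℕ → ℕ × ℕ → Set
  Bounded i j x (q , h) = suc (q + h) + suc j ≤ x + i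

  bounded-W : ∀ i j x {hs} → All (Bounded i j (suc x)) hs → All (Bounded (suc i) j (suc x)) hs
  bounded-W i j x All.[]       = All.[]
  bounded-W i j x (b All.∷ bs) = ≤-trans b (+-monoʳ-≤ (suc x) (n≤1+n i)) All.∷ bounded-W i j x bs

  bounded-NE : ∀ i j x {hs} → All (Bounded (suc i) (suc j) (suc x)) hs → All (Bounded i j (suc x)) hs
  bounded-NE i j x All.[]                 = All.[]
  bounded-NE i j x (All._∷_ {q , h} b bs) =
    ≤-pred (≤-trans (≤-reflexive (sym (+-suc (suc (q + h)) (suc j))))
      (≤-trans b (≤-reflexive (+-suc (suc x) i)))) All.∷ bounded-NE i j x bs

  bounded-E : ∀ i j x {hs} → All (Bounded (suc i) j x) hs → All (Bounded i j (suc x)) hs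
  bounded-E i j x All.[]       = All.[]
  bounded-E i j x (b All.∷ bs) = ≤-trans b (≤-reflexive (+-suc x i)) All.∷ bounded-E i j x bs

  bounded-SW : ∀ i j x {hs} → All (Bounded i j x) hs → All (Bounded (suc i) (suc j) (suc x)) hs
  bounded-SW i j x All.[]                 = All.[]
  bounded-SW i j x (All._∷_ {q , h} b bs) =
    ≤-trans (≤-reflexive (+-suc (suc (q + h)) (suc j)))
      (s≤s (≤-trans b (+-monoʳ-≤ x (n≤1+n i)))) All.∷ bounded-SW i j x bs

  hits-bounded : ∀ e i j x → All (Bounded i j x) (hits e i j x)
  hits-bounded e       i       j       zero    = All.[]
  hits-bounded zero    i       j       (suc x) = All.[]
  hits-bounded (suc e) zero    j       (suc x) =
    ++⁺ (bounded-NE 0 j x (hits-bounded e 1 (suc j) (suc x))) (bounded-E 0 j x (hits-bounded e 1 j x))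
  hits-bounded (suc e) (suc i) zero    (suc x) =
    ++⁺ (bounded-W i 0 x (hits-bounded e i 0 (suc x)))
      (++⁺ (bounded-NE (suc i) 0 x (hits-bounded e (2 + i) 1 (suc x)))
        (++⁺ (bounded-E (suc i) 0 x (hits-bounded e (2 + i) 0 x))
          (≤-reflexive hit All.∷ All.[])))
    where
    hit : suc (x + i) + 1 ≡ suc x + suc i
    hit = solve (x ∷ i ∷ [])
  hits-bounded (suc e) (suc i) (suc j) (suc x) =
    ++⁺ (bounded-W i (suc j) x (hits-bounded e i (suc j) (suc x)))
      (++⁺ (bounded-NE (suc i) (suc j) x (hits-bounded e (2 + i) (2 + j) (suc x)))
        (++⁺ (bounded-E (suc i) (suc j) x (hits-bounded e (2 + i) (suc j) x))
          (bounded-SW i j x (hits-bounded e i j x))))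

  bounded⇒≤ : ∀ k q i → Bounded 0 0 (suc k) (q , i) → q + i ≤ k
  bounded⇒≤ k q i b = ≤-trans (m≤m+n (q + i) 1) (≤-trans (≤-pred b) (≤-reflexive (+-identityʳ k)))

  hitting-from-origin : ∀ s k → halfPlane (2 * (s + k)) 0 (suc k) ≡
    quadrant s (2 * k + 2 * s) 0 0 + total s (hits (2 * k) 0 0 (suc k))
  hitting-from-origin s k =
    trans (cong (λ t → halfPlane t 0 (suc k)) steps) (first-passage s (2 * k) 0 0 (suc k) balance)
    where
    steps : 2 * (s + k) ≡ 2 * k + 2 * s
    steps = solve (s ∷ k ∷ [])
    balance : Balance s (2 * k + 2 * s) 0 0 (suc k)
    balance = start s k
      where
      start : ∀ s k → 2 * k + 2 * s + 2 * 1 ≡ 2 * s + (2 * suc k + 0)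
      start = solve-∀

-- Identification of `F` with the recursive count.

module Walks where

  open FirstPassage
  open import Data.Nat using (ℕ; zero; suc; _+_; z≤n)
  open import Data.Nat.Properties
  open import Data.Integer as ℤ using (+_; -[1+_])
  import Data.Integer.Properties as ℤ
  open import Data.List using ([]; _∷_; map; _++_; filter; length)
  open import Data.List.Properties
    using (filter-++; length-++; filter-none; filter-≐; filter-accept; filter-reject)
  open import Data.List.Relation.Unary.All using (universal)
  open import Data.Vec as Vec using (Vec)
  open import Data.Product using (_×_; _,_; proj₁)
  open import Data.Product.Properties using (≡-dec)
  open import Function using (_∘_)
  open import Relation.Nullary using (¬_; yes; no; contradiction)
  open import Relation.Nullary.Decidable using (_×-dec_)
  open import Relation.Unary using (Decidable; _≐_)
  open import Relation.Binary.PropositionalEquality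

  length-filter-map : ∀ {A B : Set} {P : B → Set} (P? : Decidable P) (f : A → B) xs →
    length (filter P? (map f xs)) ≡ length (filter (P? ∘ f) xs)
  length-filter-map P? f [] = refl
  length-filter-map P? f (x ∷ xs) with P? (f x)
  ... | yes _ = cong suc (length-filter-map P? f xs)
  ... | no  _ = length-filter-map P? f xs

  StaysTo : Point → Point → ∀ {m} → Vec Step m → Set
  StaysTo t p w = Stays p w × endpoint p w ≡ t

  staysTo? : ∀ t p {m} → Decidable (StaysTo t p {m})
  staysTo? t p w = stays? p w ×-dec ≡-dec ℤ._≟_ ℤ._≟_ (endpoint p w) t

  -- The starting point is a parameter because the recursion removes the first step; at the origin
  -- this unfolds to `F`.
  walks : Point → ℕ → Point → ℕ
  walks t m p = length (filter (staysTo? t p) (words m))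

  walks-outside : ∀ t m p → ¬ InQuadrant p → walks t m p ≡ 0
  walks-outside t m p p∉Q =
    cong length (filter-none (staysTo? t p) (universal (λ w → p∉Q ∘ start w ∘ proj₁) (words m)))
    where
    start : ∀ {m} (w : Vec Step m) → Stays p w → InQuadrant p
    start Vec.[]      p∈Q       = p∈Q
    start (_ Vec.∷ _) (p∈Q , _) = p∈Q

  walks-suc : ∀ t m p → InQuadrant p → walks t (suc m) p ≡
    walks t m (move W p) + (walks t m (move NE p) + (walks t m (move E p) + walks t m (move SW p)))
  walks-suc t m p p∈Q =
    split W _ (split NE _ (split E _ (trans (split SW [] refl) (+-identityʳ _))))
    where
    P? = staysTo? t p
    after : ∀ σ → (StaysTo t p ∘ (σ Vec.∷_)) ≐ StaysTo t (move σ p)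
    after σ = (λ { ((_ , st) , e) → st , e }) , (λ { (st , e) → (p∈Q , st) , e })
    split : ∀ σ ws {k} → length (filter P? ws) ≡ k →
      length (filter P? (map (σ Vec.∷_) (words m) ++ ws)) ≡ walks t m (move σ p) + k
    split σ ws eq =
      trans (cong length (filter-++ P? (map (σ Vec.∷_) (words m)) ws))
        (trans (length-++ (filter P? (map (σ Vec.∷_) (words m))))
          (cong₂ _+_
            (trans (length-filter-map P? (σ Vec.∷_) (words m))
              (cong length (filter-≐ (P? ∘ (σ Vec.∷_)) (staysTo? t (move σ p)) (after σ) (words m))))
            eq))

  west-outside : ∀ {a j} → ¬ InQuadrant (-[1+ a ] , j)
  west-outside (() , _)

  south-outside : ∀ {a i} → ¬ InQuadrant (i , -[1+ a ])
  south-outside (_ , ())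

  inside : ∀ i j → InQuadrant (+ i , + j)
  inside i j = ℤ.+≤+ z≤n , ℤ.+≤+ z≤n

  δ-≢ : ∀ m n → m ≢ n → δ m n ≡ 0
  δ-≢ zero    zero    m≢n = contradiction refl m≢n
  δ-≢ zero    (suc n) m≢n = refl
  δ-≢ (suc m) zero    m≢n = refl
  δ-≢ (suc m) (suc n) m≢n = δ-≢ m n (m≢n ∘ cong suc)

  walks≡quadrant : ∀ n m i j → walks (+ 0 , + n) m (+ i , + j) ≡ quadrant (suc n) m i j
  walks≡quadrant n zero zero j with j ≟ n
  ... | yes refl = trans (cong length (filter-accept (staysTo? (+ 0 , + n) (+ 0 , + n)) {Vec.[]} {[]} (inside 0 n , refl)))
                     (sym (δ-refl n))
  ... | no  j≢n  = trans (cong length (filter-reject (staysTo? (+ 0 , + n) (+ 0 , + j)) {Vec.[]} {[]} λ { (_ , refl) → j≢n refl }))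
                     (sym (δ-≢ j n j≢n))
  walks≡quadrant n zero (suc i) j =
    cong length (filter-reject (staysTo? (+ 0 , + n) (+ suc i , + j)) {Vec.[]} {[]} λ { (_ , ()) })
  walks≡quadrant n (suc m) zero j =
    trans (walks-suc t m (+ 0 , + j) (inside 0 j))
      (cong₂ _+_ (walks-outside t m (-[1+ 0 ] , + j) west-outside)
        (cong₂ _+_ (walks≡quadrant n m 1 (suc j))
          (trans (cong₂ _+_ (walks≡quadrant n m 1 j)
                   (walks-outside t m (-[1+ 0 ] , ℤ.pred (+ j)) west-outside))
            (+-identityʳ _))))
    where t = + 0 , + n
  walks≡quadrant n (suc m) (suc i) zero =
    trans (walks-suc t m (+ suc i , + 0) (inside (suc i) 0))
      (cong₂ _+_ (walks≡quadrant n m i 0)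
        (cong₂ _+_ (walks≡quadrant n m (2 + i) 1)
          (trans (cong₂ _+_ (walks≡quadrant n m (2 + i) 0)
                   (walks-outside t m (+ i , -[1+ 0 ]) south-outside))
            (+-identityʳ _))))
    where t = + 0 , + n
  walks≡quadrant n (suc m) (suc i) (suc j) =
    trans (walks-suc t m (+ suc i , + suc j) (inside (suc i) (suc j)))
      (cong₂ _+_ (walks≡quadrant n m i (suc j))
        (cong₂ _+_ (walks≡quadrant n m (2 + i) (2 + j))
          (cong₂ _+_ (walks≡quadrant n m (2 + i) (suc j)) (walks≡quadrant n m i j))))
    where t = + 0 , + n

  F≡quadrant : ∀ m n → F m (+ 0) (+ n) ≡ quadrant (suc n) m 0 0
  F≡quadrant m n = walks≡quadrant n m 0 0

  -- This is the case n = -1, whose zero count yields the root -1 of the polynomials.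
  quadrant-empty : ∀ m i j → quadrant 0 m i j ≡ 0
  quadrant-empty zero    zero    j       = refl
  quadrant-empty zero    (suc i) j       = refl
  quadrant-empty (suc m) zero    j       = cong₂ _+_ (quadrant-empty m 1 (suc j)) (quadrant-empty m 1 j)
  quadrant-empty (suc m) (suc i) zero    =
    cong₂ _+_ (quadrant-empty m i 0) (cong₂ _+_ (quadrant-empty m (2 + i) 1) (quadrant-empty m (2 + i) 0))
  quadrant-empty (suc m) (suc i) (suc j) =
    cong₂ _+_ (quadrant-empty m i (suc j)) (cong₂ _+_ (quadrant-empty m (2 + i) (2 + j))
      (cong₂ _+_ (quadrant-empty m (2 + i) (suc j)) (quadrant-empty m i j)))

-- Product formulas for the half-plane counts.

module HalfPlaneCounts where

  open FirstPassage
  open import Data.Nat using (ℕ; zero; suc; _+_; _*_; _<_; s≤s; _!)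
  open import Data.Nat.Combinatorics using (_C_; k>n⇒nCk≡0)
  open import Data.Nat.Properties
  open import Data.Nat.Tactic.RingSolver using (solve; solve-∀)
  open import Data.List using ([]; _∷_)
  open import Data.Product using (_,_)
  open import Relation.Binary.PropositionalEquality

  -- The rising factorial with step `c`: b (b + c) ... (b + (n - 1) c).
  prod : ℕ → ℕ → ℕ → ℕ
  prod c b zero    = 1
  prod c b (suc n) = b * prod c (c + b) n

  prod-last : ∀ c b n → prod c b (suc n) ≡ prod c b n * (b + c * n)
  prod-last c b zero    = solve (b ∷ c ∷ [])
  prod-last c b (suc n) = begin
    b * prod c (c + b) (suc n)                      ≡⟨ cong (b *_) (prod-last c (c + b) n) ⟩
    b * (prod c (c + b) n * (c + b + c * n))        ≡⟨ *-assoc b (prod c (c + b) n) _ ⟨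
    b * prod c (c + b) n * (c + b + c * n)          ≡⟨ cong (b * prod c (c + b) n *_) (step b c n) ⟩
    b * prod c (c + b) n * (b + c * suc n)          ∎
    where
    open ≡-Reasoning
    step : ∀ b c n → c + b + c * n ≡ b + c * suc n
    step = solve-∀

  -- D s = (2 s)! / s!, which is also 2 * 4ⁿ (3/2)ₙ for s = n + 1.
  D : ℕ → ℕ
  D = prod 4 2

  D-suc : ∀ s → D (suc s) ≡ D s * (2 + 4 * s)
  D-suc = prod-last 4 2

  D-+ : ∀ s q → D (s + q) ≡ D s * prod 4 (2 + 4 * s) q
  D-+ s zero    = trans (cong D (+-identityʳ s)) (sym (*-identityʳ (D s)))
  D-+ s (suc q) = begin
    D (s + suc q)                                          ≡⟨ cong D (+-suc s q) ⟩
    D (suc (s + q))                                        ≡⟨ D-suc (s + q) ⟩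
    D (s + q) * (2 + 4 * (s + q))                          ≡⟨ cong (_* (2 + 4 * (s + q))) (D-+ s q) ⟩
    D s * prod 4 (2 + 4 * s) q * (2 + 4 * (s + q))         ≡⟨ *-assoc (D s) (prod 4 (2 + 4 * s) q) _ ⟩
    D s * (prod 4 (2 + 4 * s) q * (2 + 4 * (s + q)))       ≡⟨ cong (λ t → D s * (prod 4 (2 + 4 * s) q * t)) (step s q) ⟩
    D s * (prod 4 (2 + 4 * s) q * (2 + 4 * s + 4 * q))     ≡⟨ cong (D s *_) (prod-last 4 (2 + 4 * s) q) ⟨
    D s * prod 4 (2 + 4 * s) (suc q)                       ∎
    where
    open ≡-Reasoning
    step : ∀ s q → 2 + 4 * (s + q) ≡ 2 + 4 * s + 4 * q
    step = solve-∀

  !-+ : ∀ m r → (m + r) ! ≡ m ! * prod 1 (suc m) r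
  !-+ m zero    = trans (cong _! (+-identityʳ m)) (sym (*-identityʳ (m !)))
  !-+ m (suc r) = begin
    (m + suc r) !                                ≡⟨ cong _! (+-suc m r) ⟩
    suc (m + r) * (m + r) !                      ≡⟨ cong (suc (m + r) *_) (!-+ m r) ⟩
    suc (m + r) * (m ! * prod 1 (suc m) r)       ≡⟨ rearrange m r (m !) (prod 1 (suc m) r) ⟩
    m ! * (prod 1 (suc m) r * (suc m + 1 * r))   ≡⟨ cong (m ! *_) (prod-last 1 (suc m) r) ⟨
    m ! * prod 1 (suc m) (suc r)                 ∎
    where
    open ≡-Reasoning
    rearrange : ∀ m r f p → suc (m + r) * (f * p) ≡ f * (p * (suc m + 1 * r))
    rearrange = solve-∀

  -- The falling factorial of `N`, read upwards from its least factor b = N - q + 1; the equation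
  -- avoids truncated subtraction. It includes b = 0, where both sides vanish: `total-formula` needs
  -- this at s = k = 0.
  C-prod : ∀ N b q → suc N ≡ b + q → (N C q) * q ! ≡ prod 1 b q
  C-prod N       b             zero    eq = refl
  C-prod zero    (suc zero)    (suc q) ()
  C-prod zero    (suc (suc b)) (suc q) ()
  C-prod N       zero          (suc q) eq =
    cong (_* (suc q) !) (k>n⇒nCk≡0 (≤-reflexive eq))
  C-prod (suc N) (suc b)       (suc q) eq = begin
    (suc N C suc q) * (suc q * q !)
      ≡⟨ cong (_* (suc q * q !)) (C-pascal N q) ⟩
    ((N C suc q) + (N C q)) * (suc q * q !)
      ≡⟨ distribute (N C suc q) (N C q) (suc q) (q !) ⟩
    (N C suc q) * (suc q) ! + suc q * ((N C q) * q !)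
      ≡⟨ cong₂ (λ u v → u + suc q * v) (C-prod N b (suc q) (suc-injective eq))
           (C-prod N (suc b) q (trans (suc-injective eq) (+-suc b q))) ⟩
    b * prod 1 (suc b) q + suc q * prod 1 (suc b) q
      ≡⟨ collect b q (prod 1 (suc b) q) ⟩
    prod 1 (suc b) q * (suc b + 1 * q)
      ≡⟨ prod-last 1 (suc b) q ⟨
    prod 1 (suc b) (suc q) ∎
    where
    open ≡-Reasoning
    distribute : ∀ u v k f → (u + v) * (k * f) ≡ u * (k * f) + k * (v * f)
    distribute = solve-∀
    collect : ∀ b q p → b * p + suc q * p ≡ p * (suc b + 1 * q)
    collect = solve-∀

  ballot-> : ∀ m i → m < i → ballot m i ≡ 0
  ballot-> zero    (suc i) _         = refl
  ballot-> (suc m) (suc i) (s≤s m<i) =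
    cong₂ _+_ (ballot-> m i m<i) (ballot-> m (2 + i) (≤-trans m<i (m≤n+m i 2)))

  -- `U` counts the steps to the right. As `D U * prod 1 (suc (2 * U)) i` is m! / U!, this is the
  -- classical ballot number (i + 1) m! / (U! (U + i + 1)!), checked against the recursion: a first
  -- step to the left keeps `U`, one to the right lowers it.
  ballot-formula : ∀ m U i → m ≡ 2 * U + i →
    ballot m i * suc (U + i) ! ≡ suc i * (D U * prod 1 (suc (2 * U)) i)
  ballot-formula zero    zero    zero    eq = refl
  ballot-formula (suc m) (suc V) zero    eq = begin
    ballot m 1 * suc (suc V + 0) !
      ≡⟨ cong (λ t → ballot m 1 * t !) V≡ ⟩
    ballot m 1 * suc (V + 1) !
      ≡⟨ ballot-formula m V 1 (trans (suc-injective eq) (solve (V ∷ []))) ⟩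
    2 * (D V * (suc (2 * V) * 1))
      ≡⟨ regroup V (D V) ⟩
    1 * ((D V * (2 + 4 * V)) * 1)
      ≡⟨ cong (λ t → 1 * (t * 1)) (D-suc V) ⟨
    1 * (D (suc V) * 1) ∎
    where
    open ≡-Reasoning
    V≡ : suc (suc V + 0) ≡ suc (V + 1)
    V≡ = solve (V ∷ [])
    regroup : ∀ V d → 2 * (d * (suc (2 * V) * 1)) ≡ 1 * ((d * (2 + 4 * V)) * 1)
    regroup = solve-∀
  -- Only the straight walk to the left remains; the other branch starts too far away.
  ballot-formula (suc m) zero    (suc i) eq = begin
    (ballot m i + ballot m (2 + i)) * (suc (suc i) * suc i !)
      ≡⟨ cong (λ t → (ballot m i + t) * (suc (suc i) * suc i !))
           (ballot-> m (2 + i) (s≤s (≤-trans (≤-reflexive m≡i) (n≤1+n i)))) ⟩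
    (ballot m i + 0) * (suc (suc i) * suc i !)
      ≡⟨ extract (ballot m i) i (suc i !) ⟩
    suc (suc i) * (ballot m i * suc i !)
      ≡⟨ cong (suc (suc i) *_) (ballot-formula m 0 i m≡i) ⟩
    suc (suc i) * (suc i * (1 * prod 1 1 i))
      ≡⟨ regroup i (prod 1 1 i) ⟩
    suc (suc i) * (1 * (prod 1 1 i * (1 + 1 * i)))
      ≡⟨ cong (λ t → suc (suc i) * (1 * t)) (prod-last 1 1 i) ⟨
    suc (suc i) * (1 * prod 1 1 (suc i)) ∎
    where
    open ≡-Reasoning
    m≡i : m ≡ i
    m≡i = suc-injective eq
    extract : ∀ b i f → (b + 0) * (suc (suc i) * f) ≡ suc (suc i) * (b * f)
    extract = solve-∀
    regroup : ∀ i p → suc (suc i) * (suc i * (1 * p)) ≡ suc (suc i) * (1 * (p * (1 + 1 * i)))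
    regroup = solve-∀
  ballot-formula (suc m) (suc V) (suc i) eq = begin
    (b₁ + b₂) * suc (suc V + suc i) !
      ≡⟨ cong (λ t → (b₁ + b₂) * suc (suc t) !) (+-suc V i) ⟩
    (b₁ + b₂) * ((3 + (V + i)) * f)
      ≡⟨ distribute b₁ b₂ (3 + (V + i)) f ⟩
    (3 + (V + i)) * (b₁ * f) + b₂ * ((3 + (V + i)) * f)
      ≡⟨ cong (λ t → (3 + (V + i)) * (b₁ * f) + b₂ * t !) V≡ ⟩
    (3 + (V + i)) * (b₁ * f) + b₂ * suc (V + (2 + i)) !
      ≡⟨ cong₂ (λ u v → (3 + (V + i)) * u + v) (ballot-formula m (suc V) i m≡)
          (ballot-formula m V (2 + i) (trans m≡ (solve (V ∷ i ∷ [])))) ⟩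
    (3 + (V + i)) * (suc i * (D (suc V) * prod 1 (suc (2 * suc V)) i))
      + (3 + i) * (D V * (suc (2 * V) * ((2 + 2 * V) * prod 1 (3 + 2 * V) i)))
      ≡⟨ cong₂ (λ u v → (3 + (V + i)) * (suc i * (u * v)) + (3 + i) * (D V * (suc (2 * V) * ((2 + 2 * V) * p))))
          (D-suc V) (cong (λ t → prod 1 t i) base≡) ⟩
    (3 + (V + i)) * (suc i * (D V * (2 + 4 * V) * p)) + (3 + i) * (D V * (suc (2 * V) * ((2 + 2 * V) * p)))
      ≡⟨ collect V i (D V) p ⟩
    (2 + i) * (D V * (2 + 4 * V) * (p * (3 + 2 * V + 1 * i)))
      ≡⟨ cong₂ (λ u v → (2 + i) * (u * v)) (D-suc V)
          (trans (cong (λ t → prod 1 t (suc i)) base≡) (prod-last 1 (3 + 2 * V) i)) ⟨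
    (2 + i) * (D (suc V) * prod 1 (suc (2 * suc V)) (suc i)) ∎
    where
    open ≡-Reasoning
    b₁ = ballot m i
    b₂ = ballot m (2 + i)
    f = (2 + (V + i)) !
    p = prod 1 (3 + 2 * V) i
    V≡ : 3 + (V + i) ≡ suc (V + (2 + i))
    V≡ = solve (V ∷ i ∷ [])
    base≡ : suc (2 * suc V) ≡ 3 + 2 * V
    base≡ = solve (V ∷ [])
    m≡ : m ≡ 2 * suc V + i
    m≡ = trans (suc-injective eq) (step V i)
      where
      step : ∀ V i → V + suc (V + 0) + suc i ≡ 2 * suc V + i
      step = solve-∀
    distribute : ∀ a b c f → (a + b) * (c * f) ≡ c * (a * f) + b * (c * f)
    distribute = solve-∀
    collect : ∀ V i d p →
      (3 + (V + i)) * (suc i * (d * (2 + 4 * V) * p)) + (3 + i) * (d * (suc (2 * V) * ((2 + 2 * V) * p)))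
        ≡ (2 + i) * (d * (2 + 4 * V) * (p * (3 + 2 * V + 1 * i)))
    collect = solve-∀

  -- The ballot number with U = s + q gives the first two products, after `D s` is split off, and
  -- the binomial coefficient gives the third. The fourth pads the factorial: r = k - (q + i) turns
  -- it into `(s + suc k) !`, common to all entries and to `total-formula`.
  afterHit-formula : ∀ s q i r →
    afterHit s (q , i) * q ! * (s + (suc (q + i) + r)) ! ≡
    D s * (suc i * (prod 4 (2 + 4 * s) q * (prod 1 (1 + 2 * q + 2 * s) i
      * (prod 1 (1 + q + i + 2 * s) q * prod 1 (2 + q + i + 1 * s) r))))
  afterHit-formula s q i r = begin
    b * c * q ! * (s + (suc (q + i) + r)) !
      ≡⟨ cong (λ t → b * c * q ! * t !) s≡ ⟩
    b * c * q ! * (suc (s + q + i) + r) !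
      ≡⟨ cong (b * c * q ! *_) (!-+ (suc (s + q + i)) r) ⟩
    b * c * q ! * (suc (s + q + i) ! * prod 1 (2 + (s + q + i)) r)
      ≡⟨ regroup b c (q !) (suc (s + q + i) !) (prod 1 (2 + (s + q + i)) r) ⟩
    b * suc (s + q + i) ! * (c * q ! * prod 1 (2 + (s + q + i)) r)
      ≡⟨ cong₂ (λ u v → u * (v * prod 1 (2 + (s + q + i)) r))
          (ballot-formula m (s + q) i refl) (C-prod m (1 + q + i + 2 * s) q b₃≡) ⟩
    suc i * (D (s + q) * prod 1 (suc (2 * (s + q))) i) * (p₃ * prod 1 (2 + (s + q + i)) r)
      ≡⟨ cong₂ (λ u v → suc i * (D (s + q) * prod 1 u i) * (p₃ * prod 1 v r)) b₂≡ b₄≡ ⟩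
    suc i * (D (s + q) * p₂) * (p₃ * p₄)
      ≡⟨ cong (λ u → suc i * (u * p₂) * (p₃ * p₄)) (D-+ s q) ⟩
    suc i * (D s * p₁ * p₂) * (p₃ * p₄)
      ≡⟨ reorder (suc i) (D s) p₁ p₂ p₃ p₄ ⟩
    D s * (suc i * (p₁ * (p₂ * (p₃ * p₄)))) ∎
    where
    open ≡-Reasoning
    m = 2 * (s + q) + i
    b = ballot m i
    c = m C q
    p₁ = prod 4 (2 + 4 * s) q
    p₂ = prod 1 (1 + 2 * q + 2 * s) i
    p₃ = prod 1 (1 + q + i + 2 * s) q
    p₄ = prod 1 (2 + q + i + 1 * s) r
    s≡ : s + (suc (q + i) + r) ≡ suc (s + q + i) + r
    s≡ = solve (s ∷ q ∷ i ∷ r ∷ [])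
    b₂≡ : suc (2 * (s + q)) ≡ 1 + 2 * q + 2 * s
    b₂≡ = solve (s ∷ q ∷ [])
    b₃≡ : suc (2 * (s + q) + i) ≡ 1 + q + i + 2 * s + q
    b₃≡ = solve (s ∷ q ∷ i ∷ [])
    b₄≡ : 2 + (s + q + i) ≡ 2 + q + i + 1 * s
    b₄≡ = solve (s ∷ q ∷ i ∷ [])
    regroup : ∀ b c f g p → b * c * f * (g * p) ≡ b * g * (c * f * p)
    regroup = solve-∀
    reorder : ∀ i d p₁ p₂ p₃ p₄ → i * (d * p₁ * p₂) * (p₃ * p₄) ≡ d * (i * (p₁ * (p₂ * (p₃ * p₄))))
    reorder = solve-∀

  total-formula : ∀ s k →
    halfPlane (2 * (s + k)) 0 (suc k) * (suc k) ! * (s + suc k) ! ≡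
    D s * (prod 4 (2 + 4 * s) k * prod 1 (k + 2 * s) (suc k))
  total-formula s k = begin
    b * c * (suc k) ! * (s + suc k) !
      ≡⟨ cong (λ t → b * c * (suc k) ! * t !) s≡ ⟩
    b * c * (suc k) ! * suc (s + k + 0) !
      ≡⟨ regroup b c ((suc k) !) (suc (s + k + 0) !) ⟩
    b * suc (s + k + 0) ! * (c * (suc k) !)
      ≡⟨ cong₂ _*_ (ballot-formula m (s + k) 0 (sym (+-identityʳ m)))
          (C-prod m (k + 2 * s) (suc k) b₂≡) ⟩
    1 * (D (s + k) * 1) * p₂
      ≡⟨ cong (λ t → 1 * (t * 1) * p₂) (D-+ s k) ⟩
    1 * (D s * p₁ * 1) * p₂
      ≡⟨ reorder (D s) p₁ p₂ ⟩
    D s * (p₁ * p₂) ∎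
    where
    open ≡-Reasoning
    m = 2 * (s + k)
    b = ballot m 0
    c = m C suc k
    p₁ = prod 4 (2 + 4 * s) k
    p₂ = prod 1 (k + 2 * s) (suc k)
    s≡ : s + suc k ≡ suc (s + k + 0)
    s≡ = solve (s ∷ k ∷ [])
    b₂≡ : suc (2 * (s + k)) ≡ k + 2 * s + suc k
    b₂≡ = solve (s ∷ k ∷ [])
    regroup : ∀ b c f g → b * c * f * g ≡ b * g * (c * f)
    regroup = solve-∀
    reorder : ∀ d p₁ p₂ → 1 * (d * p₁ * 1) * p₂ ≡ d * (p₁ * p₂)
    reorder = solve-∀

-- The explicit cases of excess 0, 2, 4 and 6.

module SmallExcess where

  open FirstPassage
  open Walks
  open HalfPlaneCounts
  open import Data.Nat using (suc; _+_; _*_; _^_; _!)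
  open import Data.Nat.Properties
  open import Data.Nat.Tactic.RingSolver using (solve-∀)
  open import Data.Integer using (+_)
  open import Data.Product using (_,_)
  open import Relation.Binary.PropositionalEquality

  -- No E or SW step can occur, so the count is the Catalan number (2n)! / (n! (n + 1)!).
  excess-0 : ∀ n → F (2 * n) (+ 0) (+ n) * (suc n) ! ≡ D n
  excess-0 n = begin
    F (2 * n) (+ 0) (+ n) * (suc n) !
      ≡⟨ cong (_* (suc n) !) (trans (F≡quadrant (2 * n) n)
           (sym (ballot≡quadrant (suc n) (2 * n) 0 0 (balance n)))) ⟩
    ballot (2 * n) 0 * (suc n) !
      ≡⟨ cong (λ t → ballot (2 * n) 0 * suc t !) (sym (+-identityʳ n)) ⟩
    ballot (2 * n) 0 * (suc (n + 0)) !
      ≡⟨ ballot-formula (2 * n) n 0 (sym (+-identityʳ _)) ⟩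
    1 * (D n * 1)
      ≡⟨ simplify (D n) ⟩
    D n ∎
    where
    open ≡-Reasoning
    balance : ∀ n → 2 * n + 2 * 1 ≡ 2 * suc n + (2 * 0 + 0)
    balance = solve-∀
    simplify : ∀ d → 1 * (d * 1) ≡ d
    simplify = solve-∀

  F-excess : ∀ k n → F (2 * n + 2 * suc k) (+ 0) (+ n) ≡ quadrant (suc n) (2 * k + 2 * suc n) 0 0
  F-excess k n = trans (F≡quadrant (2 * n + 2 * suc k) n) (cong (λ m → quadrant (suc n) m 0 0) (steps k n))
    where
    steps : ∀ k n → 2 * n + 2 * suc k ≡ 2 * k + 2 * suc n
    steps = solve-∀

  excess-formula : ∀ k n → let s = suc n in
    (F (2 * n + 2 * suc k) (+ 0) (+ n) + total s (hits (2 * k) 0 0 (suc k))) * (suc k) ! * (s + suc k) !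
      ≡ D s * (prod 4 (2 + 4 * s) k * prod 1 (k + 2 * s) (suc k))
  excess-formula k n =
    trans (cong (λ t → t * (suc k) ! * (suc n + suc k) !)
        (trans (cong (λ t → t + total (suc n) (hits (2 * k) 0 0 (suc k))) (F-excess k n)) (sym (hitting-from-origin (suc n) k))))
      (total-formula (suc n) k)

  excess-1 : ∀ n → F (2 * n + 2) (+ 0) (+ n) * (2 * (suc n + 1) !) * 1 ≡ D (suc n) * 2 ! * (2 * (n + 1))
  excess-1 n =
    trans (left (F (2 * n + 2) (+ 0) (+ n)) ((suc n + 1) !))
      (trans (cong (2 *_) (excess-formula 0 n)) (right n (D (suc n))))
    where
    left : ∀ f S → f * (2 * S) * 1 ≡ 2 * ((f + 0) * 1 * S)
    left = solve-∀
    right : ∀ n d → 2 * (d * (1 * ((2 * suc n) * 1))) ≡ d * 2 * (2 * (n + 1))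
    right = solve-∀

  -- The only beginning is E, SW, with entry (0 , 0). Its contribution is added to both sides
  -- instead of being subtracted.
  excess-2 : ∀ n → F (2 * n + 4) (+ 0) (+ n) * (2 * (suc n + 2) !) * 3 ≡
    D (suc n) * 3 ! * ((n + 1) * (8 * n ^ 2 + 32 * n + 33))
  excess-2 n = +-cancelʳ-≡ (6 * (h * 1 * S)) _ _ (begin
    f * (2 * S) * 3 + 6 * (h * 1 * S)
      ≡⟨ left f h S ⟩
    3 * ((f + (h + 0)) * 2 * S)
      ≡⟨ cong (3 *_) (excess-formula 1 n) ⟩
    3 * (D s * (prod 4 (2 + 4 * s) 1 * prod 1 (1 + 2 * s) 2))
      ≡⟨ right n (D s) ⟩
    D s * 6 * ((n + 1) * (8 * n ^ 2 + 32 * n + 33)) + 6 * (D s * (1 * (1 * (1 * (1 * prod 1 (2 + 1 * s) 1)))))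
      ≡⟨ cong (λ t → D s * 6 * ((n + 1) * (8 * n ^ 2 + 32 * n + 33)) + 6 * t) (afterHit-formula s 0 0 1) ⟨
    D s * 6 * ((n + 1) * (8 * n ^ 2 + 32 * n + 33)) + 6 * (h * 1 * S) ∎)
    where
    open ≡-Reasoning
    s = suc n
    S = (s + 2) !
    f = F (2 * n + 4) (+ 0) (+ n)
    h = afterHit s (0 , 0)
    left : ∀ f h S → f * (2 * S) * 3 + 6 * (h * 1 * S) ≡ 3 * ((f + (h + 0)) * 2 * S)
    left = solve-∀
    right : ∀ n d →
      3 * (d * (((2 + 4 * suc n) * 1) * ((1 + 2 * suc n) * ((1 + (1 + 2 * suc n)) * 1))))
        ≡ d * 6 * ((n + 1) * (8 * (n * (n * 1)) + 32 * n + 33))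
          + 6 * (d * (1 * (1 * (1 * (1 * ((2 + 1 * suc n) * 1))))))
    right = solve-∀

  -- `hits 4 0 0 3` evaluates to five entries (0 , 0) from beginnings of four steps, then (0 , 1)
  -- from E, E, SW and (1 , 0) from E, SW. The constant 36 is 4 * 9, from the 4ⁿ⁻¹ and the 9 of the
  -- formula.
  excess-3 : ∀ n → F (2 * n + 6) (+ 0) (+ n) * (2 * (suc n + 3) !) * 36 ≡
    D (suc n) * 4 ! * ((n + 1) * (64 * n ^ 4 + 672 * n ^ 3 + 2648 * n ^ 2 + 4641 * n + 3060))
  excess-3 n = +-cancelʳ-≡ (72 * (5 * (h * 1 * S) + h′ * 1 * S + h″ * 1 * S)) _ _ (begin
    f * (2 * S) * 36 + 72 * (5 * (h * 1 * S) + h′ * 1 * S + h″ * 1 * S)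
      ≡⟨ left f h h′ h″ S ⟩
    12 * ((f + T) * 6 * S)
      ≡⟨ cong (12 *_) (excess-formula 2 n) ⟩
    12 * (D s * (prod 4 (2 + 4 * s) 2 * prod 1 (2 + 2 * s) 3))
      ≡⟨ right n (D s) ⟩
    N + 72 * (5 * X + X′ + X″)
      ≡⟨ cong (λ t → N + 72 * t) (cong₂ _+_ (cong₂ (λ u v → 5 * u + v)
           (afterHit-formula s 0 0 2) (afterHit-formula s 0 1 1)) (afterHit-formula s 1 0 1)) ⟨
    N + 72 * (5 * (h * 1 * S) + h′ * 1 * S + h″ * 1 * S) ∎)
    where
    open ≡-Reasoning
    s = suc n
    S = (s + 3) !
    f = F (2 * n + 6) (+ 0) (+ n)
    h = afterHit s (0 , 0)
    h′ = afterHit s (0 , 1)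
    h″ = afterHit s (1 , 0)
    T = (h + (h + (h + (h + (h + (h′ + (h″ + 0)))))))
    N = D s * 24 * ((n + 1) * (64 * n ^ 4 + 672 * n ^ 3 + 2648 * n ^ 2 + 4641 * n + 3060))
    X = D s * (1 * (1 * (1 * (1 * prod 1 (2 + 1 * s) 2))))
    X′ = D s * (2 * (1 * (prod 1 (1 + 2 * s) 1 * (1 * prod 1 (3 + 1 * s) 1))))
    X″ = D s * (1 * (prod 4 (2 + 4 * s) 1 * (1 * (prod 1 (2 + 2 * s) 1 * prod 1 (3 + 1 * s) 1))))
    left : ∀ f h h′ h″ S →
      f * (2 * S) * 36 + 72 * (5 * (h * 1 * S) + h′ * 1 * S + h″ * 1 * S)
        ≡ 12 * ((f + (h + (h + (h + (h + (h + (h′ + (h″ + 0)))))))) * 6 * S)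
    left = solve-∀
    right : ∀ n d → 
      12 * (d * (((2 + 4 * suc n) * ((4 + (2 + 4 * suc n)) * 1))
        * ((2 + 2 * suc n) * ((1 + (2 + 2 * suc n)) * ((1 + (1 + (2 + 2 * suc n))) * 1)))))
        ≡ d * 24 * ((n + 1) * (64 * (n * (n * (n * (n * 1)))) + 672 * (n * (n * (n * 1)))
            + 2648 * (n * (n * 1)) + 4641 * n + 3060))
          + 72 * (5 * (d * (1 * (1 * (1 * (1 * ((2 + 1 * suc n) * ((1 + (2 + 1 * suc n)) * 1)))))))
            + d * (2 * (1 * (((1 + 2 * suc n) * 1) * (1 * ((3 + 1 * suc n) * 1)))))
            + d * (1 * (((2 + 4 * suc n) * 1) * (1 * (((2 + 2 * suc n) * 1) * ((3 + 1 * suc n) * 1))))))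
    right = solve-∀

-- Rational arithmetic, polynomials and the closed forms.

module RationalFunctions where

  open FirstPassage
  open Walks
  open HalfPlaneCounts
  open SmallExcess
  open import Data.Nat as ℕ using (ℕ; zero; suc; _≤_; s≤s; _!; _^_)
  import Data.Nat.Properties as ℕ
  import Data.Nat.Tactic.RingSolver as ℕ-Solver
  open import Data.Integer as ℤ using (+_)
  import Data.Integer.Properties as ℤ
  open import Data.Rational using (ℚ; 0ℚ; 1ℚ; _+_; _*_; -_; _/_; 1/_; Positive; NonZero; fromℚᵘ)
  open import Data.Rational.Properties
  import Data.Rational.Unnormalised as ℚᵘ
  import Data.Rational.Unnormalised.Properties as ℚᵘ
  open import Data.List using (List; []; _∷_; map; foldr)
  open import Data.List.Relation.Unary.All as All using (All)
  open import Data.Product using (_×_; _,_; Σ-syntax; proj₁; proj₂)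
  open import Function using (_∘_)
  open import Level using (0ℓ)
  open import Relation.Nullary.Decidable using (dec⇒maybe)
  open import Relation.Binary.PropositionalEquality
  open import Tactic.RingSolver using () renaming (solve-∀ to solve-∀-in)
  open import Tactic.RingSolver.Core.AlmostCommutativeRing using (AlmostCommutativeRing; fromCommutativeRing)

  ℚ-ring : AlmostCommutativeRing 0ℓ 0ℓ
  ℚ-ring = fromCommutativeRing +-*-commutativeRing (λ x → dec⇒maybe (0ℚ ≟ x))

  -- With an explicit positive denominator `_/_` unfolds to `fromℚᵘ`, so fractions can be computed
  -- unnormalised, with no reasoning about common divisors.
  fromℚᵘ-+ : ∀ p q → fromℚᵘ p + fromℚᵘ q ≡ fromℚᵘ (p ℚᵘ.+ q)
  fromℚᵘ-+ p q = toℚᵘ-injective (ℚᵘ.≃-trans (toℚᵘ-homo-+ (fromℚᵘ p) (fromℚᵘ q))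
    (ℚᵘ.≃-trans (ℚᵘ.+-cong (toℚᵘ-fromℚᵘ p) (toℚᵘ-fromℚᵘ q)) (ℚᵘ.≃-sym (toℚᵘ-fromℚᵘ (p ℚᵘ.+ q)))))

  fromℚᵘ-* : ∀ p q → fromℚᵘ p * fromℚᵘ q ≡ fromℚᵘ (p ℚᵘ.* q)
  fromℚᵘ-* p q = toℚᵘ-injective (ℚᵘ.≃-trans (toℚᵘ-homo-* (fromℚᵘ p) (fromℚᵘ q))
    (ℚᵘ.≃-trans (ℚᵘ.*-cong (toℚᵘ-fromℚᵘ p) (toℚᵘ-fromℚᵘ q)) (ℚᵘ.≃-sym (toℚᵘ-fromℚᵘ (p ℚᵘ.* q)))))

  fromℕ-+ : ∀ m n → fromℕ (m ℕ.+ n) ≡ fromℕ m + fromℕ n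
  fromℕ-+ m n = sym (trans (fromℚᵘ-+ (ℚᵘ.mkℚᵘ (+ m) 0) (ℚᵘ.mkℚᵘ (+ n) 0))
    (cong (_/ 1) (cong₂ ℤ._+_ (ℤ.*-identityʳ (+ m)) (ℤ.*-identityʳ (+ n)))))

  /-*-/ : ∀ m n d e .{{_ : ℕ.NonZero d}} .{{_ : ℕ.NonZero e}} →
    (+ m / d) * (+ n / e) ≡ (+ (m ℕ.* n) / (d ℕ.* e)) {{ℕ.m*n≢0 d e}}
  /-*-/ m n (suc d) (suc e) = trans (fromℚᵘ-* (ℚᵘ.mkℚᵘ (+ m) d) (ℚᵘ.mkℚᵘ (+ n) e))
    (cong (_/ (suc d ℕ.* suc e)) (sym (ℤ.pos-* m n)))

  fromℕ-* : ∀ m n → fromℕ (m ℕ.* n) ≡ fromℕ m * fromℕ n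
  fromℕ-* m n = sym (/-*-/ m n 1 1)

  /-*-cancel : ∀ m d .{{_ : ℕ.NonZero d}} → (+ m / d) * fromℕ d ≡ fromℕ m
  /-*-cancel m d@(suc d-1) = trans (fromℚᵘ-* (ℚᵘ.mkℚᵘ (+ m) d-1) (ℚᵘ.mkℚᵘ (+ d) 0))
    (fromℚᵘ-cong {ℚᵘ.mkℚᵘ (+ m) d-1 ℚᵘ.* ℚᵘ.mkℚᵘ (+ d) 0} {ℚᵘ.mkℚᵘ (+ m) 0} (ℚᵘ.*≡* (cancel (+ m))))
    where
    cancel : ∀ a → (a ℤ.* + d) ℤ.* + 1 ≡ a ℤ.* + (d ℕ.* 1)
    cancel a = trans (ℤ.*-identityʳ (a ℤ.* + d)) (cong (λ t → a ℤ.* + t) (sym (ℕ.*-identityʳ d)))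

  fromℕ-pos : ∀ n .{{_ : ℕ.NonZero n}} → Positive (fromℕ n)
  fromℕ-pos n = normalize-pos n 1

  *-cancelʳ-pos : ∀ {p q} r .{{_ : Positive r}} → p * r ≡ q * r → p ≡ q
  *-cancelʳ-pos {p} {q} r eq = begin
    p                ≡⟨ *-identityʳ p ⟨
    p * 1ℚ           ≡⟨ cong (p *_) (*-inverseʳ r) ⟨
    p * (r * 1/ r)   ≡⟨ *-assoc p r (1/ r) ⟨
    p * r * 1/ r     ≡⟨ cong (_* 1/ r) eq ⟩
    q * r * 1/ r     ≡⟨ *-assoc q r (1/ r) ⟩
    q * (r * 1/ r)   ≡⟨ cong (q *_) (*-inverseʳ r) ⟩
    q * 1ℚ           ≡⟨ *-identityʳ q ⟩
    q                ∎
    where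
    open ≡-Reasoning
    instance
      r≢0 : NonZero r
      r≢0 = pos⇒nonZero r

  coeff-+ₚ : ∀ p q i → coeff (p +ₚ q) i ≡ coeff p i + coeff q i
  coeff-+ₚ []      q       i       = sym (+-identityˡ _)
  coeff-+ₚ (a ∷ p) []      i       = sym (+-identityʳ _)
  coeff-+ₚ (a ∷ p) (b ∷ q) zero    = refl
  coeff-+ₚ (a ∷ p) (b ∷ q) (suc i) = coeff-+ₚ p q i

  coeff-map : ∀ a p i → coeff (map (a *_) p) i ≡ a * coeff p i
  coeff-map a []      i       = sym (*-zeroʳ a)
  coeff-map a (b ∷ p) zero    = refl
  coeff-map a (b ∷ p) (suc i) = coeff-map a p i

  eval-+ₚ : ∀ p q x → eval (p +ₚ q) x ≡ eval p x + eval q x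
  eval-+ₚ []      q       x = sym (+-identityˡ _)
  eval-+ₚ (a ∷ p) []      x = sym (+-identityʳ _)
  eval-+ₚ (a ∷ p) (b ∷ q) x =
    trans (cong (λ t → a + b + x * t) (eval-+ₚ p q x)) (rearrange a b x (eval p x) (eval q x))
    where
    rearrange : ∀ a b x u v → a + b + x * (u + v) ≡ a + x * u + (b + x * v)
    rearrange = solve-∀-in ℚ-ring

  eval-map : ∀ a p x → eval (map (a *_) p) x ≡ a * eval p x
  eval-map a []      x = sym (*-zeroʳ a)
  eval-map a (b ∷ p) x =
    trans (cong (λ t → a * b + x * t) (eval-map a p x)) (rearrange a b x (eval p x))
    where
    rearrange : ∀ a b x u → a * b + x * (a * u) ≡ a * (b + x * u)
    rearrange = solve-∀-in ℚ-ring

  coeff-linear-zero : ∀ b a p → coeff ((b ∷ a ∷ []) *ₚ p) 0 ≡ b * coeff p 0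
  coeff-linear-zero b a p = trans (coeff-+ₚ (map (b *_) p) _ 0)
    (trans (+-identityʳ _) (coeff-map b p 0))

  coeff-linear-suc : ∀ b a p i → coeff ((b ∷ a ∷ []) *ₚ p) (suc i) ≡ b * coeff p (suc i) + a * coeff p i
  coeff-linear-suc b a p i = trans (coeff-+ₚ (map (b *_) p) _ (suc i))
    (cong₂ _+_ (coeff-map b p (suc i))
      (trans (coeff-+ₚ (map (a *_) p) (0ℚ ∷ []) i)
        (trans (cong₂ _+_ (coeff-map a p i) (zero-coeff i)) (+-identityʳ _))))
    where
    zero-coeff : ∀ i → coeff (0ℚ ∷ []) i ≡ 0ℚ
    zero-coeff zero    = refl
    zero-coeff (suc i) = refl

  eval-linear : ∀ b a p x → eval ((b ∷ a ∷ []) *ₚ p) x ≡ (b + x * a) * eval p x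
  eval-linear b a p x = begin
    eval (map (b *_) p +ₚ (0ℚ ∷ (map (a *_) p +ₚ (0ℚ ∷ [])))) x
      ≡⟨ eval-+ₚ (map (b *_) p) _ x ⟩
    eval (map (b *_) p) x + (0ℚ + x * eval (map (a *_) p +ₚ (0ℚ ∷ [])) x)
      ≡⟨ cong₂ (λ u v → u + (0ℚ + x * v)) (eval-map b p x)
          (trans (eval-+ₚ (map (a *_) p) (0ℚ ∷ []) x) (cong (_+ (0ℚ + x * 0ℚ)) (eval-map a p x))) ⟩
    b * eval p x + (0ℚ + x * (a * eval p x + (0ℚ + x * 0ℚ)))
      ≡⟨ rearrange b a x (eval p x) ⟩
    (b + x * a) * eval p x ∎
    where
    open ≡-Reasoning
    rearrange : ∀ b a x u → b * u + (0ℚ + x * (a * u + (0ℚ + x * 0ℚ))) ≡ (b + x * a) * u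
    rearrange = solve-∀-in ℚ-ring

  -1ℚ : ℚ
  -1ℚ = - 1ℚ

  -- Synthetic division by X + 1: the coefficients of the quotient are the Horner tails of `p`
  -- evaluated at -1, and the remainder is the value of `p` there.
  quotient : Poly → Poly
  quotient []      = []
  quotient (b ∷ p) = eval p -1ℚ ∷ quotient p

  coeff-quotient-zero : ∀ p → coeff p 0 ≡ coeff (quotient p) 0 + eval p -1ℚ
  coeff-quotient-zero []      = refl
  coeff-quotient-zero (b ∷ p) = rearrange b (eval p -1ℚ)
    where
    rearrange : ∀ b e → b ≡ e + (b + - 1ℚ * e)
    rearrange = solve-∀-in ℚ-ring

  coeff-quotient-suc : ∀ p i → coeff p (suc i) ≡ coeff (quotient p) (suc i) + coeff (quotient p) i
  coeff-quotient-suc []      i       = refl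
  coeff-quotient-suc (b ∷ p) zero    = coeff-quotient-zero p
  coeff-quotient-suc (b ∷ p) (suc i) = coeff-quotient-suc p i

  X+1-∣ₚ : ∀ p → eval p -1ℚ ≡ 0ℚ → X+1 ∣ₚ p
  X+1-∣ₚ p root = q , agrees
    where
    q = quotient p
    agrees : p ≈ₚ X+1 *ₚ q
    agrees zero    = begin
      coeff p 0                 ≡⟨ coeff-quotient-zero p ⟩
      coeff q 0 + eval p -1ℚ    ≡⟨ cong (λ t → coeff q 0 + t) root ⟩
      coeff q 0 + 0ℚ            ≡⟨ +-identityʳ (coeff q 0) ⟩
      coeff q 0                 ≡⟨ *-identityˡ (coeff q 0) ⟨
      1ℚ * coeff q 0            ≡⟨ coeff-linear-zero 1ℚ 1ℚ q ⟨
      coeff (X+1 *ₚ q) 0        ∎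
      where open ≡-Reasoning
    agrees (suc i) = begin
      coeff p (suc i)                          ≡⟨ coeff-quotient-suc p i ⟩
      coeff q (suc i) + coeff q i              ≡⟨ cong₂ _+_ (*-identityˡ (coeff q (suc i))) (*-identityˡ (coeff q i)) ⟨
      1ℚ * coeff q (suc i) + 1ℚ * coeff q i    ≡⟨ coeff-linear-suc 1ℚ 1ℚ q i ⟨
      coeff (X+1 *ₚ q) (suc i)                 ∎
      where open ≡-Reasoning

  -- Degrees, leading coefficients and values of products of linear factors.

  Vanishes : Poly → ℕ → Set
  Vanishes p d = ∀ i → d ≤ i → coeff p i ≡ 0ℚ

  linear-vanishes : ∀ b a p d → Vanishes p d → Vanishes ((b ∷ a ∷ []) *ₚ p) (suc d)
  linear-vanishes b a p d v (suc i) (s≤s d≤i) =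
    trans (coeff-linear-suc b a p i)
      (trans (cong₂ (λ u w → b * u + a * w) (v (suc i) (ℕ.m≤n⇒m≤1+n d≤i)) (v i d≤i))
        (cong₂ _+_ (*-zeroʳ b) (*-zeroʳ a)))

  linear-lead : ∀ b a p d → Vanishes p (suc d) → coeff ((b ∷ a ∷ []) *ₚ p) (suc d) ≡ a * coeff p d
  linear-lead b a p d v =
    trans (coeff-linear-suc b a p d)
      (trans (cong (λ u → b * u + a * coeff p d) (v (suc d) ℕ.≤-refl))
        (trans (cong (_+ a * coeff p d) (*-zeroʳ b)) (+-identityˡ _)))

  -- Multiplies p by the polynomial in n whose value is prod c (b + a * s) k at s = n + 1.
  prodₚ : (c a b k : ℕ) → Poly → Poly
  prodₚ c a b zero    p = p
  prodₚ c a b (suc k) p = (fromℕ (a ℕ.+ b) ∷ fromℕ a ∷ []) *ₚ prodₚ c a (c ℕ.+ b) k p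

  prodₚ-vanishes : ∀ c a b k p d → Vanishes p d → Vanishes (prodₚ c a b k p) (k ℕ.+ d)
  prodₚ-vanishes c a b zero    p d v = v
  prodₚ-vanishes c a b (suc k) p d v =
    linear-vanishes (fromℕ (a ℕ.+ b)) (fromℕ a) (prodₚ c a (c ℕ.+ b) k p) (k ℕ.+ d) (prodₚ-vanishes c a (c ℕ.+ b) k p d v)

  prodₚ-lead-pos : ∀ c a b k p d .{{_ : ℕ.NonZero a}} → Vanishes p (suc d) →
    Positive (coeff p d) → Positive (coeff (prodₚ c a b k p) (k ℕ.+ d))
  prodₚ-lead-pos c a b zero    p d v pos = pos
  prodₚ-lead-pos c a b (suc k) p d v pos =
    subst Positive
      (sym (linear-lead (fromℕ (a ℕ.+ b)) (fromℕ a) q (k ℕ.+ d)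
        (subst (Vanishes q) (ℕ.+-suc k d) (prodₚ-vanishes c a (c ℕ.+ b) k p (suc d) v))))
      (pos*pos⇒pos (fromℕ a) {{fromℕ-pos a}} (coeff q (k ℕ.+ d))
        {{prodₚ-lead-pos c a (c ℕ.+ b) k p d v pos}})
    where q = prodₚ c a (c ℕ.+ b) k p

  eval-prodₚ : ∀ s x → x + 1ℚ ≡ fromℕ s → ∀ c a b k p →
    eval (prodₚ c a b k p) x ≡ fromℕ (prod c (b ℕ.+ a ℕ.* s) k) * eval p x
  eval-prodₚ s x x+1≡s c a b zero    p = sym (*-identityˡ _)
  eval-prodₚ s x x+1≡s c a b (suc k) p = begin
    eval ((fromℕ (a ℕ.+ b) ∷ fromℕ a ∷ []) *ₚ prodₚ c a (c ℕ.+ b) k p) x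
      ≡⟨ eval-linear (fromℕ (a ℕ.+ b)) (fromℕ a) (prodₚ c a (c ℕ.+ b) k p) x ⟩
    (fromℕ (a ℕ.+ b) + x * fromℕ a) * eval (prodₚ c a (c ℕ.+ b) k p) x
      ≡⟨ cong₂ _*_ factor (eval-prodₚ s x x+1≡s c a (c ℕ.+ b) k p) ⟩
    fromℕ (b ℕ.+ a ℕ.* s) * (fromℕ (prod c (c ℕ.+ b ℕ.+ a ℕ.* s) k) * eval p x)
      ≡⟨ *-assoc (fromℕ (b ℕ.+ a ℕ.* s)) _ (eval p x) ⟨
    fromℕ (b ℕ.+ a ℕ.* s) * fromℕ (prod c (c ℕ.+ b ℕ.+ a ℕ.* s) k) * eval p x
      ≡⟨ cong (_* eval p x) (fromℕ-* (b ℕ.+ a ℕ.* s) _) ⟨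
    fromℕ ((b ℕ.+ a ℕ.* s) ℕ.* prod c (c ℕ.+ b ℕ.+ a ℕ.* s) k) * eval p x
      ≡⟨ cong (λ t → fromℕ ((b ℕ.+ a ℕ.* s) ℕ.* prod c t k) * eval p x) (ℕ.+-assoc c b (a ℕ.* s)) ⟩
    fromℕ (prod c (b ℕ.+ a ℕ.* s) (suc k)) * eval p x ∎
    where
    open ≡-Reasoning
    rearrange : ∀ A B x → A + B + x * A ≡ B + A * (x + 1ℚ)
    rearrange = solve-∀-in ℚ-ring
    factor : fromℕ (a ℕ.+ b) + x * fromℕ a ≡ fromℕ (b ℕ.+ a ℕ.* s)
    factor = begin
      fromℕ (a ℕ.+ b) + x * fromℕ a        ≡⟨ cong (_+ x * fromℕ a) (fromℕ-+ a b) ⟩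
      fromℕ a + fromℕ b + x * fromℕ a      ≡⟨ rearrange (fromℕ a) (fromℕ b) x ⟩
      fromℕ b + fromℕ a * (x + 1ℚ)         ≡⟨ cong (λ t → fromℕ b + fromℕ a * t) x+1≡s ⟩
      fromℕ b + fromℕ a * fromℕ s          ≡⟨ cong (λ t → fromℕ b + t) (fromℕ-* a s) ⟨
      fromℕ b + fromℕ (a ℕ.* s)            ≡⟨ fromℕ-+ b (a ℕ.* s) ⟨
      fromℕ (b ℕ.+ a ℕ.* s)                ∎

  -- Turns a product formula for a count `h` into the value `P * c` of a polynomial times the common
  -- prefactor. The 2 on both sides is `D 1`, which relates `D (suc n)` to 4ⁿ (3/2)ₙ.
  rescale : ∀ h S Q d N P G c .{{_ : ℕ.NonZero Q}} →
    h ℕ.* Q ℕ.* S ≡ d ℕ.* (N ℕ.* P) → c * fromℕ (G ℕ.* Q) ≡ fromℕ (2 ℕ.* N) →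
    fromℕ h * fromℕ (2 ℕ.* S) ≡ fromℕ (d ℕ.* G) * (fromℕ P * c)
  rescale h S Q d N P G c eq c-eq = *-cancelʳ-pos (fromℕ Q) {{fromℕ-pos Q}} (begin
    fromℕ h * fromℕ (2 ℕ.* S) * fromℕ Q
      ≡⟨ trans (cong (_* fromℕ Q) (sym (fromℕ-* h (2 ℕ.* S)))) (sym (fromℕ-* (h ℕ.* (2 ℕ.* S)) Q)) ⟩
    fromℕ (h ℕ.* (2 ℕ.* S) ℕ.* Q)
      ≡⟨ cong fromℕ (trans (left h S Q) (trans (cong (2 ℕ.*_) eq) (right d N P))) ⟩
    fromℕ (d ℕ.* P ℕ.* (2 ℕ.* N))
      ≡⟨ trans (fromℕ-* (d ℕ.* P) (2 ℕ.* N)) (cong₂ _*_ (fromℕ-* d P) (sym c-eq)) ⟩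
    fromℕ d * fromℕ P * (c * fromℕ (G ℕ.* Q))
      ≡⟨ cong (λ t → fromℕ d * fromℕ P * (c * t)) (fromℕ-* G Q) ⟩
    fromℕ d * fromℕ P * (c * (fromℕ G * fromℕ Q))
      ≡⟨ rearrange (fromℕ d) (fromℕ P) c (fromℕ G) (fromℕ Q) ⟩
    fromℕ d * fromℕ G * (fromℕ P * c) * fromℕ Q
      ≡⟨ cong (λ t → t * (fromℕ P * c) * fromℕ Q) (fromℕ-* d G) ⟨
    fromℕ (d ℕ.* G) * (fromℕ P * c) * fromℕ Q ∎)
    where
    open ≡-Reasoning
    left : ∀ h S Q → h ℕ.* (2 ℕ.* S) ℕ.* Q ≡ 2 ℕ.* (h ℕ.* Q ℕ.* S)
    left = ℕ-Solver.solve-∀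
    right : ∀ d N P → 2 ℕ.* (d ℕ.* (N ℕ.* P)) ≡ d ℕ.* P ℕ.* (2 ℕ.* N)
    right = ℕ-Solver.solve-∀
    rearrange : ∀ d P c G Q → d * P * (c * (G * Q)) ≡ d * G * (P * c) * Q
    rearrange = solve-∀-in ℚ-ring

  -- From here to closed-form-suc, k stands for the paper's k - 1. The prefactor
  -- 4ⁿ (3/2)ₙ / (k + 3)ₙ is D s (k + 2)! / (2 (s + k + 1)!) at s = n + 1, and dividing
  -- a half-plane count by it leaves 2 (i + 1) / ((k + 2)! q!) times linear factors.
  weight : ℕ → ℕ → ℕ → ℚ
  weight k q i = (+ (2 ℕ.* suc i) / ((2 ℕ.+ k) ! ℕ.* q !)) {{ℕ.m*n≢0 ((2 ℕ.+ k) !) (q !) {{(2 ℕ.+ k) ℕ.!≢0}} {{q ℕ.!≢0}}}}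

  weight-* : ∀ k q i → weight k q i * fromℕ ((2 ℕ.+ k) ! ℕ.* q !) ≡ fromℕ (2 ℕ.* suc i)
  weight-* k q i = /-*-cancel (2 ℕ.* suc i) ((2 ℕ.+ k) ! ℕ.* q !)
    {{ℕ.m*n≢0 ((2 ℕ.+ k) !) (q !) {{(2 ℕ.+ k) ℕ.!≢0}} {{q ℕ.!≢0}}}}

  weight-pos : ∀ k q i → Positive (weight k q i)
  weight-pos k q i = normalize-pos (2 ℕ.* suc i) ((2 ℕ.+ k) ! ℕ.* q !)
    {{ℕ.m*n≢0 ((2 ℕ.+ k) !) (q !) {{(2 ℕ.+ k) ℕ.!≢0}} {{q ℕ.!≢0}}}}

  -- The polynomial of the theorem and its degree.

  hitPoly : ℕ → ℚ → ℕ × ℕ → Poly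
  hitPoly k c (q , i) =
    prodₚ 4 4 2 q (prodₚ 1 2 (1 ℕ.+ 2 ℕ.* q) i (prodₚ 1 2 (1 ℕ.+ q ℕ.+ i) q
      -- The padding of `afterHit-formula`; the subtraction is exact on the entries in use, by
      -- `bounded⇒≤`.
      (prodₚ 1 1 (2 ℕ.+ q ℕ.+ i) (k ℕ.∸ (q ℕ.+ i)) (c ∷ []))))

  -- The minus sign sits in the constant factor, so `+ₚ` alone performs the subtraction.
  corrections : ℕ → List (ℕ × ℕ) → Poly
  corrections k = foldr (λ h → hitPoly k (- weight k (proj₁ h) (proj₂ h)) h +ₚ_) []

  mainPoly : ℕ → Poly
  mainPoly k = prodₚ 4 4 2 k (prodₚ 1 2 k (suc k) (weight k (suc k) 0 ∷ []))

  gesselPoly : ℕ → Poly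
  gesselPoly k = mainPoly k +ₚ corrections k (hits (2 ℕ.* k) 0 0 (suc k))

  constant-vanishes : ∀ c → Vanishes (c ∷ []) 1
  constant-vanishes c (suc i) _ = refl

  vanishes-≤ : ∀ {p d e} → d ≤ e → Vanishes p d → Vanishes p e
  vanishes-≤ d≤e v i e≤i = v i (ℕ.≤-trans d≤e e≤i)

  -- There are q + i + q + r = q + k linear factors, at most 2 k, against 2 k + 1 in `mainPoly`.
  hitPoly-vanishes : ∀ k c q i → Bounded 0 0 (suc k) (q , i) → Vanishes (hitPoly k c (q , i)) (k ℕ.+ (suc k ℕ.+ 0))
  hitPoly-vanishes k c q i b =
    vanishes-≤ {hitPoly k c (q , i)} degree≤
      (prodₚ-vanishes 4 4 2 q _ _ (prodₚ-vanishes 1 2 (1 ℕ.+ 2 ℕ.* q) i _ _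
        (prodₚ-vanishes 1 2 (1 ℕ.+ q ℕ.+ i) q _ _
          (prodₚ-vanishes 1 1 (2 ℕ.+ q ℕ.+ i) r (c ∷ []) 1 (constant-vanishes c)))))
    where
    r = k ℕ.∸ (q ℕ.+ i)
    q+i≤k : q ℕ.+ i ≤ k
    q+i≤k = bounded⇒≤ k q i b
    regroup : ∀ q i r → q ℕ.+ (i ℕ.+ (q ℕ.+ (r ℕ.+ 1))) ≡ q ℕ.+ suc (q ℕ.+ i ℕ.+ r ℕ.+ 0)
    regroup = ℕ-Solver.solve-∀
    degree≤ : q ℕ.+ (i ℕ.+ (q ℕ.+ (r ℕ.+ 1))) ≤ k ℕ.+ (suc k ℕ.+ 0)
    degree≤ = ℕ.≤-trans (ℕ.≤-reflexive (trans (regroup q i r)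
        (cong (λ t → q ℕ.+ suc (t ℕ.+ 0)) (ℕ.m+[n∸m]≡n q+i≤k))))
      (ℕ.+-monoˡ-≤ _ (ℕ.≤-trans (ℕ.m≤m+n q i) q+i≤k))

  corrections-vanish : ∀ k {hs} → All (Bounded 0 0 (suc k)) hs → Vanishes (corrections k hs) (k ℕ.+ (suc k ℕ.+ 0))
  corrections-vanish k All.[] i d≤i = refl
  corrections-vanish k (All._∷_ {q , h} {hs} b bs) i d≤i =
    trans (coeff-+ₚ (hitPoly k (- weight k q h) (q , h)) (corrections k hs) i)
      (cong₂ _+_ (hitPoly-vanishes k (- weight k q h) q h b i d≤i) (corrections-vanish k bs i d≤i))

  -- The bound is what `2 * suc k ∸ 1` computes to. The corrections do not reach this degree, and
  -- the coefficient of `mainPoly` is nonzero because it is a product of positive numbers.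
  gesselPoly-degree : ∀ k → HasDegree (gesselPoly k) (k ℕ.+ (suc k ℕ.+ 0))
  gesselPoly-degree k = lead≢0 , λ i d<i →
    trans (coeff-+ₚ (mainPoly k) cs i)
      (cong₂ _+_ (prodₚ-vanishes 4 4 2 k inner (suc k ℕ.+ 1) inner-vanishes i
          (subst (_≤ i) (sym (degree k)) d<i)) (cs-vanish i (ℕ.<⇒≤ d<i)))
    where
    d = k ℕ.+ (suc k ℕ.+ 0)
    hs = hits (2 ℕ.* k) 0 0 (suc k)
    cs = corrections k hs
    w = weight k (suc k) 0
    inner = prodₚ 1 2 k (suc k) (w ∷ [])
    cs-vanish : Vanishes cs d
    cs-vanish = corrections-vanish k (hits-bounded (2 ℕ.* k) 0 0 (suc k))
    degree : ∀ k → k ℕ.+ (suc k ℕ.+ 1) ≡ suc (k ℕ.+ (suc k ℕ.+ 0))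
    degree = ℕ-Solver.solve-∀
    inner-vanishes : Vanishes inner (suc k ℕ.+ 1)
    inner-vanishes = prodₚ-vanishes 1 2 k (suc k) (w ∷ []) 1 (constant-vanishes w)
    lead-pos : Positive (coeff (mainPoly k) d)
    lead-pos = prodₚ-lead-pos 4 4 2 k inner (suc k ℕ.+ 0)
      (subst (Vanishes inner) (ℕ.+-suc (suc k) 0) inner-vanishes)
      (prodₚ-lead-pos 1 2 k (suc k) (w ∷ []) 0 (constant-vanishes w) (weight-pos k (suc k) 0))
    lead≢0 : coeff (gesselPoly k) d ≢ 0ℚ
    lead≢0 eq = <⇒≢ (positive⁻¹ (coeff (mainPoly k) d) {{lead-pos}})
      (sym (trans (sym (trans (coeff-+ₚ (mainPoly k) cs d)
        (trans (cong (λ t → coeff (mainPoly k) d + t) (cs-vanish d ℕ.≤-refl)) (+-identityʳ _)))) eq))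

  -- Values of the polynomials at x = s - 1.

  module _ (s : ℕ) (x : ℚ) (x+1≡s : x + 1ℚ ≡ fromℕ s) where

    private
      A : ℕ → ℚ
      A k = fromℕ (2 ℕ.* (s ℕ.+ suc k) !)

      B : ℕ → ℚ
      B k = fromℕ (D s ℕ.* (2 ℕ.+ k) !)

    eval-constant : ∀ c → eval (c ∷ []) x ≡ c
    eval-constant c = trans (cong (λ t → c + t) (*-zeroʳ x)) (+-identityʳ c)

    eval-mainPoly : ∀ k → fromℕ (halfPlane (2 ℕ.* (s ℕ.+ k)) 0 (suc k)) * A k ≡ B k * eval (mainPoly k) x
    eval-mainPoly k = trans
      (rescale (halfPlane (2 ℕ.* (s ℕ.+ k)) 0 (suc k)) ((s ℕ.+ suc k) !) ((suc k) !) (D s) 1 (p₁ ℕ.* p₂) ((2 ℕ.+ k) !) w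
        {{suc k ℕ.!≢0}} (trans (total-formula s k) (cong (D s ℕ.*_) (sym (ℕ.+-identityʳ _)))) (weight-* k (suc k) 0))
      (cong (B k *_) (sym (begin
        eval (mainPoly k) x
          ≡⟨ eval-prodₚ s x x+1≡s 4 4 2 k _ ⟩
        fromℕ p₁ * eval (prodₚ 1 2 k (suc k) (w ∷ [])) x
          ≡⟨ cong (fromℕ p₁ *_) (eval-prodₚ s x x+1≡s 1 2 k (suc k) (w ∷ [])) ⟩
        fromℕ p₁ * (fromℕ p₂ * eval (w ∷ []) x)
          ≡⟨ cong (λ t → fromℕ p₁ * (fromℕ p₂ * t)) (eval-constant w) ⟩
        fromℕ p₁ * (fromℕ p₂ * w)
          ≡⟨ *-assoc (fromℕ p₁) (fromℕ p₂) w ⟨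
        fromℕ p₁ * fromℕ p₂ * w
          ≡⟨ cong (_* w) (fromℕ-* p₁ p₂) ⟨
        fromℕ (p₁ ℕ.* p₂) * w ∎)))
      where
      open ≡-Reasoning
      w = weight k (suc k) 0
      p₁ = prod 4 (2 ℕ.+ 4 ℕ.* s) k
      p₂ = prod 1 (k ℕ.+ 2 ℕ.* s) (suc k)

    eval-hitPoly : ∀ k q i → Bounded 0 0 (suc k) (q , i) →
      fromℕ (afterHit s (q , i)) * A k + B k * eval (hitPoly k (- weight k q i) (q , i)) x ≡ 0ℚ
    eval-hitPoly k q i b = begin
      fromℕ (afterHit s (q , i)) * A k + B k * eval (hitPoly k (- w) (q , i)) x
        ≡⟨ cong₂ (λ u v → u + B k * v)
             (rescale (afterHit s (q , i)) ((s ℕ.+ suc k) !) (q !) (D s) (suc i) P ((2 ℕ.+ k) !) w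
               {{q ℕ.!≢0}} formula (weight-* k q i))
             evaluated ⟩
      B k * (fromℕ P * w) + B k * (fromℕ P * - w)
        ≡⟨ cancel (B k) (fromℕ P) w ⟩
      0ℚ ∎
      where
      open ≡-Reasoning
      w = weight k q i
      r = k ℕ.∸ (q ℕ.+ i)
      p₁ = prod 4 (2 ℕ.+ 4 ℕ.* s) q
      p₂ = prod 1 (1 ℕ.+ 2 ℕ.* q ℕ.+ 2 ℕ.* s) i
      p₃ = prod 1 (1 ℕ.+ q ℕ.+ i ℕ.+ 2 ℕ.* s) q
      p₄ = prod 1 (2 ℕ.+ q ℕ.+ i ℕ.+ 1 ℕ.* s) r
      P = p₁ ℕ.* (p₂ ℕ.* (p₃ ℕ.* p₄))
      q+i≤k : q ℕ.+ i ≤ k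
      q+i≤k = bounded⇒≤ k q i b
      formula : afterHit s (q , i) ℕ.* q ! ℕ.* (s ℕ.+ suc k) ! ≡ D s ℕ.* (suc i ℕ.* P)
      formula = trans (cong (λ t → afterHit s (q , i) ℕ.* q ! ℕ.* (s ℕ.+ suc t) !) (sym (ℕ.m+[n∸m]≡n q+i≤k)))
        (afterHit-formula s q i r)
      cancel : ∀ B P w → B * (P * w) + B * (P * - w) ≡ 0ℚ
      cancel = solve-∀-in ℚ-ring
      regroup : ∀ a b c d w → a * (b * (c * (d * w))) ≡ a * (b * (c * d)) * w
      regroup = solve-∀-in ℚ-ring
      evaluated : eval (hitPoly k (- w) (q , i)) x ≡ fromℕ P * - w
      evaluated = begin
        eval (hitPoly k (- w) (q , i)) x
          ≡⟨ eval-prodₚ s x x+1≡s 4 4 2 q _ ⟩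
        fromℕ p₁ * eval (prodₚ 1 2 (1 ℕ.+ 2 ℕ.* q) i _) x
          ≡⟨ cong (fromℕ p₁ *_) (eval-prodₚ s x x+1≡s 1 2 (1 ℕ.+ 2 ℕ.* q) i _) ⟩
        fromℕ p₁ * (fromℕ p₂ * eval (prodₚ 1 2 (1 ℕ.+ q ℕ.+ i) q _) x)
          ≡⟨ cong (λ t → fromℕ p₁ * (fromℕ p₂ * t)) (eval-prodₚ s x x+1≡s 1 2 (1 ℕ.+ q ℕ.+ i) q _) ⟩
        fromℕ p₁ * (fromℕ p₂ * (fromℕ p₃ * eval (prodₚ 1 1 (2 ℕ.+ q ℕ.+ i) r (- w ∷ [])) x))
          ≡⟨ cong (λ t → fromℕ p₁ * (fromℕ p₂ * (fromℕ p₃ * t)))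
               (trans (eval-prodₚ s x x+1≡s 1 1 (2 ℕ.+ q ℕ.+ i) r (- w ∷ []))
                 (cong (fromℕ p₄ *_) (eval-constant (- w)))) ⟩
        fromℕ p₁ * (fromℕ p₂ * (fromℕ p₃ * (fromℕ p₄ * - w)))
          ≡⟨ regroup (fromℕ p₁) (fromℕ p₂) (fromℕ p₃) (fromℕ p₄) (- w) ⟩
        fromℕ p₁ * (fromℕ p₂ * (fromℕ p₃ * fromℕ p₄)) * - w
          ≡⟨ cong (_* - w) (trans (fromℕ-* p₁ _) (cong (fromℕ p₁ *_)
               (trans (fromℕ-* p₂ _) (cong (fromℕ p₂ *_) (fromℕ-* p₃ p₄))))) ⟨
        fromℕ P * - w ∎

    eval-corrections : ∀ k {hs} → All (Bounded 0 0 (suc k)) hs →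
      fromℕ (total s hs) * A k + B k * eval (corrections k hs) x ≡ 0ℚ
    eval-corrections k All.[] = zeros (A k) (B k)
      where
      zeros : ∀ A B → 0ℚ * A + B * 0ℚ ≡ 0ℚ
      zeros = solve-∀-in ℚ-ring
    eval-corrections k (All._∷_ {q , i} {hs} b bs) = begin
      fromℕ (h ℕ.+ t) * A k + B k * eval (p +ₚ cs) x
        ≡⟨ cong₂ (λ u v → u * A k + B k * v) (fromℕ-+ h t) (eval-+ₚ p cs x) ⟩
      (fromℕ h + fromℕ t) * A k + B k * (eval p x + eval cs x)
        ≡⟨ regroup (fromℕ h) (fromℕ t) (A k) (B k) (eval p x) (eval cs x) ⟩
      (fromℕ h * A k + B k * eval p x) + (fromℕ t * A k + B k * eval cs x)
        ≡⟨ cong₂ _+_ (eval-hitPoly k q i b) (eval-corrections k bs) ⟩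
      0ℚ ∎
      where
      open ≡-Reasoning
      h = afterHit s (q , i)
      t = total s hs
      p = hitPoly k (- weight k q i) (q , i)
      cs = corrections k hs
      regroup : ∀ h t A B p c → (h + t) * A + B * (p + c) ≡ (h * A + B * p) + (t * A + B * c)
      regroup = solve-∀-in ℚ-ring

    -- Since `x` and `s` are tied only by x + 1 = s, one proof serves x = n with s = n + 1, for the
    -- closed form, and x = -1 with s = 0, for the root.
    eval-gesselPoly : ∀ k → fromℕ (quadrant s (2 ℕ.* k ℕ.+ 2 ℕ.* s) 0 0) * A k ≡ B k * eval (gesselPoly k) x
    eval-gesselPoly k = begin
      fromℕ Q * A k
        ≡⟨ +-identityʳ _ ⟨
      fromℕ Q * A k + 0ℚ
        ≡⟨ cong (λ t → fromℕ Q * A k + t) (eval-corrections k (hits-bounded (2 ℕ.* k) 0 0 (suc k))) ⟨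
      fromℕ Q * A k + (fromℕ (total s hs) * A k + B k * eval cs x)
        ≡⟨ regroup (fromℕ Q) (fromℕ (total s hs)) (A k) (B k * eval cs x) ⟩
      (fromℕ Q + fromℕ (total s hs)) * A k + B k * eval cs x
        ≡⟨ cong (λ t → t * A k + B k * eval cs x) (fromℕ-+ Q (total s hs)) ⟨
      fromℕ (Q ℕ.+ total s hs) * A k + B k * eval cs x
        ≡⟨ cong (λ t → fromℕ t * A k + B k * eval cs x) (hitting-from-origin s k) ⟨
      fromℕ (halfPlane (2 ℕ.* (s ℕ.+ k)) 0 (suc k)) * A k + B k * eval cs x
        ≡⟨ cong (_+ B k * eval cs x) (eval-mainPoly k) ⟩
      B k * eval (mainPoly k) x + B k * eval cs x
        ≡⟨ *-distribˡ-+ (B k) (eval (mainPoly k) x) (eval cs x) ⟨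
      B k * (eval (mainPoly k) x + eval cs x)
        ≡⟨ cong (B k *_) (eval-+ₚ (mainPoly k) cs x) ⟨
      B k * eval (gesselPoly k) x ∎
      where
      open ≡-Reasoning
      Q = quadrant s (2 ℕ.* k ℕ.+ 2 ℕ.* s) 0 0
      hs = hits (2 ℕ.* k) 0 0 (suc k)
      cs = corrections k hs
      regroup : ∀ q t A c → q * A + (t * A + c) ≡ (q + t) * A + c
      regroup = solve-∀-in ℚ-ring

  -- n = -1 corresponds to s = 0: the target (0 , -1) is outside the quadrant.
  gesselPoly-root : ∀ k → eval (gesselPoly k) -1ℚ ≡ 0ℚ
  gesselPoly-root k = *-cancelʳ-pos G {{fromℕ-pos (1 ℕ.* (2 ℕ.+ k) !) {{ℕ.m*n≢0 1 ((2 ℕ.+ k) !) {{_}} {{(2 ℕ.+ k) ℕ.!≢0}}}}}} (begin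
    eval (gesselPoly k) -1ℚ * G
      ≡⟨ *-comm _ G ⟩
    G * eval (gesselPoly k) -1ℚ
      ≡⟨ eval-gesselPoly 0 -1ℚ refl k ⟨
    fromℕ (quadrant 0 (2 ℕ.* k ℕ.+ 0) 0 0) * S
      ≡⟨ cong (λ t → fromℕ t * S) (quadrant-empty (2 ℕ.* k ℕ.+ 0) 0 0) ⟩
    0ℚ * S
      ≡⟨ *-zeroˡ S ⟩
    0ℚ
      ≡⟨ *-zeroˡ G ⟨
    0ℚ * G ∎)
    where
    open ≡-Reasoning
    G = fromℕ (1 ℕ.* (2 ℕ.+ k) !)
    S = fromℕ (2 ℕ.* (suc k) !)

  -- Pochhammer symbols and the closed forms.

  ≡-÷ : ∀ {x} y a n .{{_ : ℕ.NonZero a}} → x * poch (fromℕ a) n ≡ y → x ≡ y ÷⟨ a ⟩ n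
  ≡-÷ {x} y a n eq = begin
    x                 ≡⟨ *-identityʳ x ⟨
    x * 1ℚ            ≡⟨ cong (x *_) (*-inverseʳ P) ⟨
    x * (P * 1/ P)    ≡⟨ *-assoc x P (1/ P) ⟨
    x * P * 1/ P      ≡⟨ cong (_* 1/ P) eq ⟩
    y * 1/ P          ∎
    where
    open ≡-Reasoning
    P = poch (fromℕ a) n
    instance
      P≢0 : NonZero P
      P≢0 = pos⇒nonZero P {{poch-pos (fromℕ a) n {{normalize-pos a 1}}}}

  poch-! : ∀ a n → poch (fromℕ (suc a)) n * fromℕ (a !) ≡ fromℕ ((n ℕ.+ a) !)
  poch-! a zero    = *-identityˡ _
  poch-! a (suc n) = begin
    P * (fromℕ (suc a) + fromℕ n) * fromℕ (a !)
      ≡⟨ rearrange P (fromℕ (suc a)) (fromℕ n) (fromℕ (a !)) ⟩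
    (fromℕ n + fromℕ (suc a)) * (P * fromℕ (a !))
      ≡⟨ cong₂ _*_ (sym (fromℕ-+ n (suc a))) (poch-! a n) ⟩
    fromℕ (n ℕ.+ suc a) * fromℕ ((n ℕ.+ a) !)
      ≡⟨ fromℕ-* (n ℕ.+ suc a) ((n ℕ.+ a) !) ⟨
    fromℕ ((n ℕ.+ suc a) ℕ.* (n ℕ.+ a) !)
      ≡⟨ cong (λ t → fromℕ (t ℕ.* (n ℕ.+ a) !)) (ℕ.+-suc n a) ⟩
    fromℕ ((suc n ℕ.+ a) !) ∎
    where
    open ≡-Reasoning
    P = poch (fromℕ (suc a)) n
    rearrange : ∀ P a n f → P * (a + n) * f ≡ (n + a) * (P * f)
    rearrange = solve-∀-in ℚ-ring

  -- Four times the factor s + 1/2 + n is 2 + 4 (s + n), the next factor of `D`. The values s = 0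
  -- and s = 1 give (1/2)ₙ and (3/2)ₙ, with `D 0` = 1 and `D 1` = 2.
  poch-D : ∀ s n → fromℕ (4 ^ n) * poch (+ (1 ℕ.+ 2 ℕ.* s) / 2) n * fromℕ (D s) ≡ fromℕ (D (s ℕ.+ n))
  poch-D s zero    = trans (*-identityˡ (fromℕ (D s))) (cong (fromℕ ∘ D) (sym (ℕ.+-identityʳ s)))
  poch-D s (suc n) = begin
    fromℕ (4 ℕ.* 4 ^ n) * (P * (h + fromℕ n)) * fromℕ (D s)
      ≡⟨ cong (λ t → t * (P * (h + fromℕ n)) * fromℕ (D s)) (fromℕ-* 4 (4 ^ n)) ⟩
    fromℕ 4 * fromℕ (4 ^ n) * (P * (h + fromℕ n)) * fromℕ (D s)
      -- `fromℕ 4` and `fromℕ 2 * fromℕ 2` agree by evaluation.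
      ≡⟨ rearrange (fromℕ 2) (fromℕ (4 ^ n)) P h (fromℕ n) (fromℕ (D s)) ⟩
    fromℕ (4 ^ n) * P * fromℕ (D s) * (fromℕ 2 * (h * fromℕ 2) + fromℕ 4 * fromℕ n)
      ≡⟨ cong₂ _*_ (poch-D s n) (cong₂ _+_
           (trans (cong (fromℕ 2 *_) (/-*-cancel (1 ℕ.+ 2 ℕ.* s) 2)) (sym (fromℕ-* 2 (1 ℕ.+ 2 ℕ.* s))))
           (sym (fromℕ-* 4 n))) ⟩
    fromℕ (D (s ℕ.+ n)) * (fromℕ (2 ℕ.* (1 ℕ.+ 2 ℕ.* s)) + fromℕ (4 ℕ.* n))
      ≡⟨ cong (fromℕ (D (s ℕ.+ n)) *_) (fromℕ-+ (2 ℕ.* (1 ℕ.+ 2 ℕ.* s)) (4 ℕ.* n)) ⟨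
    fromℕ (D (s ℕ.+ n)) * fromℕ (2 ℕ.* (1 ℕ.+ 2 ℕ.* s) ℕ.+ 4 ℕ.* n)
      ≡⟨ fromℕ-* (D (s ℕ.+ n)) _ ⟨
    fromℕ (D (s ℕ.+ n) ℕ.* (2 ℕ.* (1 ℕ.+ 2 ℕ.* s) ℕ.+ 4 ℕ.* n))
      ≡⟨ cong fromℕ (trans (cong (D (s ℕ.+ n) ℕ.*_) (regroup s n))
           (trans (sym (D-suc (s ℕ.+ n))) (cong D (sym (ℕ.+-suc s n))))) ⟩
    fromℕ (D (s ℕ.+ suc n)) ∎
    where
    open ≡-Reasoning
    h = + (1 ℕ.+ 2 ℕ.* s) / 2
    P = poch h n
    rearrange : ∀ t f P h n d → t * t * f * (P * (h + n)) * d ≡ f * P * d * (t * (h * t) + t * t * n)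
    rearrange = solve-∀-in ℚ-ring
    regroup : ∀ s n → 2 ℕ.* (1 ℕ.+ 2 ℕ.* s) ℕ.+ 4 ℕ.* n ≡ 2 ℕ.+ 4 ℕ.* (s ℕ.+ n)
    regroup = ℕ-Solver.solve-∀

  ÷-*ʳ : ∀ x y a n .{{_ : ℕ.NonZero a}} → x ÷⟨ a ⟩ n * y ≡ x * y ÷⟨ a ⟩ n
  ÷-*ʳ x y a n = swap x y ((1/ poch (fromℕ a) n) {{pos⇒nonZero (poch (fromℕ a) n) {{poch-pos (fromℕ a) n {{normalize-pos a 1}}}}}})
    where
    swap : ∀ x y z → x * z * y ≡ x * y * z
    swap = solve-∀-in ℚ-ring

  -- By `poch-!` and `poch-D`, the fraction 4ⁿ (3/2)ₙ / (a + 2)ₙ equals D (n + 1) (a + 1)! / (2 (n +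
  -- a + 1)!).
  closed-form : ∀ a n f z →
    fromℕ f * fromℕ (2 ℕ.* (suc n ℕ.+ a) !) ≡ fromℕ (D (suc n) ℕ.* (suc a) !) * z →
    fromℕ f ≡ fromℕ (4 ^ n) * poch (+ 3 / 2) n ÷⟨ 2 ℕ.+ a ⟩ n * z
  closed-form a n f z eq =
    trans (≡-÷ (fromℕ (4 ^ n) * T * z) (2 ℕ.+ a) n (*-cancelʳ-pos (G * fromℕ 2) {{pos*pos⇒pos G {{fromℕ-pos ((suc a) !) {{suc a ℕ.!≢0}}}} (fromℕ 2)}} (begin
      fromℕ f * P * (G * fromℕ 2)
        ≡⟨ regroup (fromℕ f) P G (fromℕ 2) ⟩
      fromℕ f * (fromℕ 2 * (P * G))
        ≡⟨ cong (λ t → fromℕ f * (fromℕ 2 * t)) (trans (poch-! (suc a) n) (cong (fromℕ ∘ _!) (ℕ.+-suc n a))) ⟩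
      fromℕ f * (fromℕ 2 * fromℕ ((suc n ℕ.+ a) !))
        ≡⟨ cong (fromℕ f *_) (fromℕ-* 2 ((suc n ℕ.+ a) !)) ⟨
      fromℕ f * fromℕ (2 ℕ.* (suc n ℕ.+ a) !)
        ≡⟨ eq ⟩
      fromℕ (D (suc n) ℕ.* (suc a) !) * z
        ≡⟨ cong (_* z) (trans (fromℕ-* (D (suc n)) ((suc a) !)) (cong (_* G) (sym (poch-D 1 n)))) ⟩
      fromℕ (4 ^ n) * T * fromℕ 2 * G * z
        ≡⟨ reorder (fromℕ (4 ^ n) * T) (fromℕ 2) G z ⟩
      fromℕ (4 ^ n) * T * z * (G * fromℕ 2) ∎)))
      (sym (÷-*ʳ (fromℕ (4 ^ n) * T) z (2 ℕ.+ a) n))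
    where
    open ≡-Reasoning
    P = poch (fromℕ (2 ℕ.+ a)) n
    T = poch (+ 3 / 2) n
    G = fromℕ ((suc a) !)
    regroup : ∀ f P G t → f * P * (G * t) ≡ f * (t * (P * G))
    regroup = solve-∀-in ℚ-ring
    reorder : ∀ u t G z → u * t * G * z ≡ u * z * (G * t)
    reorder = solve-∀-in ℚ-ring

  closed-form-/ : ∀ a n f N d .{{_ : ℕ.NonZero d}} →
    f ℕ.* (2 ℕ.* (suc n ℕ.+ a) !) ℕ.* d ≡ D (suc n) ℕ.* (suc a) ! ℕ.* N →
    fromℕ f ≡ fromℕ (4 ^ n) * (+ N / d) * poch (+ 3 / 2) n ÷⟨ 2 ℕ.+ a ⟩ n
  closed-form-/ a n f N d eq = begin
    fromℕ f
      ≡⟨ closed-form a n f (+ N / d) (*-cancelʳ-pos (fromℕ d) {{fromℕ-pos d}} (begin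
        fromℕ f * fromℕ S * fromℕ d           ≡⟨ cong (_* fromℕ d) (fromℕ-* f S) ⟨
        fromℕ (f ℕ.* S) * fromℕ d             ≡⟨ fromℕ-* (f ℕ.* S) d ⟨
        fromℕ (f ℕ.* S ℕ.* d)                 ≡⟨ cong fromℕ eq ⟩
        fromℕ (G ℕ.* N)                       ≡⟨ fromℕ-* G N ⟩
        fromℕ G * fromℕ N                     ≡⟨ cong (fromℕ G *_) (/-*-cancel N d) ⟨
        fromℕ G * ((+ N / d) * fromℕ d)       ≡⟨ *-assoc (fromℕ G) (+ N / d) (fromℕ d) ⟨
        fromℕ G * (+ N / d) * fromℕ d         ∎)) ⟩
    fromℕ (4 ^ n) * T ÷⟨ 2 ℕ.+ a ⟩ n * (+ N / d)
      ≡⟨ ÷-*ʳ (fromℕ (4 ^ n) * T) (+ N / d) (2 ℕ.+ a) n ⟩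
    fromℕ (4 ^ n) * T * (+ N / d) ÷⟨ 2 ℕ.+ a ⟩ n
      ≡⟨ cong (λ t → t ÷⟨ 2 ℕ.+ a ⟩ n) (swap (fromℕ (4 ^ n)) T (+ N / d)) ⟩
    fromℕ (4 ^ n) * (+ N / d) * T ÷⟨ 2 ℕ.+ a ⟩ n ∎
    where
    open ≡-Reasoning
    S = 2 ℕ.* (suc n ℕ.+ a) !
    G = D (suc n) ℕ.* (suc a) !
    T = poch (+ 3 / 2) n
    swap : ∀ x y z → x * y * z ≡ x * z * y
    swap = solve-∀-in ℚ-ring

  fromℕ-*-/ : ∀ m n d .{{_ : ℕ.NonZero d}} → fromℕ m * (+ n / d) ≡ + (m ℕ.* n) / d
  fromℕ-*-/ m n d = *-cancelʳ-pos (fromℕ d) {{fromℕ-pos d}} (begin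
    fromℕ m * (+ n / d) * fromℕ d       ≡⟨ *-assoc (fromℕ m) (+ n / d) (fromℕ d) ⟩
    fromℕ m * ((+ n / d) * fromℕ d)     ≡⟨ cong (fromℕ m *_) (/-*-cancel n d) ⟩
    fromℕ m * fromℕ n                   ≡⟨ fromℕ-* m n ⟨
    fromℕ (m ℕ.* n)                     ≡⟨ /-*-cancel (m ℕ.* n) d ⟨
    (+ (m ℕ.* n) / d) * fromℕ d         ∎)
    where open ≡-Reasoning

  with-coefficient : ∀ a n f {y y′} → y ≡ y′ →
    fromℕ f ≡ y * poch (+ 3 / 2) n ÷⟨ 2 ℕ.+ a ⟩ n → fromℕ f ≡ y′ * poch (+ 3 / 2) n ÷⟨ 2 ℕ.+ a ⟩ n
  with-coefficient a n f refl eq = eq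

  -- The count involves `D n`, the prefactor `D (suc n)`; their ratio 2 (2 n + 1) is the origin of
  -- the denominator 2 n + 1.
  closed-form-0 : ∀ n → fromℕ (F (2 ℕ.* n) (+ 0) (+ n)) ≡ (+ (4 ^ n) / suc (2 ℕ.* n)) * poch (+ 3 / 2) n ÷⟨ 2 ⟩ n
  closed-form-0 n = with-coefficient 0 n f
    (trans (fromℕ-*-/ (4 ^ n) 1 (suc (2 ℕ.* n))) (cong (λ t → + t / suc (2 ℕ.* n)) (ℕ.*-identityʳ (4 ^ n))))
    (closed-form-/ 0 n f 1 (suc (2 ℕ.* n)) (begin
      f ℕ.* (2 ℕ.* (suc n ℕ.+ 0) !) ℕ.* suc (2 ℕ.* n)
        ≡⟨ cong (λ t → f ℕ.* (2 ℕ.* t !) ℕ.* suc (2 ℕ.* n)) (ℕ.+-identityʳ (suc n)) ⟩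
      f ℕ.* (2 ℕ.* (suc n) !) ℕ.* suc (2 ℕ.* n)
        ≡⟨ regroup f ((suc n) !) n ⟩
      f ℕ.* (suc n) ! ℕ.* (2 ℕ.+ 4 ℕ.* n)
        ≡⟨ cong (ℕ._* (2 ℕ.+ 4 ℕ.* n)) (excess-0 n) ⟩
      D n ℕ.* (2 ℕ.+ 4 ℕ.* n)
        ≡⟨ D-suc n ⟨
      D (suc n)
        ≡⟨ trans (ℕ.*-identityʳ _) (ℕ.*-identityʳ _) ⟨
      D (suc n) ℕ.* 1 ℕ.* 1 ∎))
    where
    open ≡-Reasoning
    f = F (2 ℕ.* n) (+ 0) (+ n)
    regroup : ∀ f S n → f ℕ.* (2 ℕ.* S) ℕ.* suc (2 ℕ.* n) ≡ f ℕ.* S ℕ.* (2 ℕ.+ 4 ℕ.* n)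
    regroup = ℕ-Solver.solve-∀

  closed-form-0′ : ∀ n → fromℕ (F (2 ℕ.* n) (+ 0) (+ n)) ≡ fromℕ (4 ^ n) * poch (+ 1 / 2) n ÷⟨ 2 ⟩ n
  closed-form-0′ n = ≡-÷ (fromℕ (4 ^ n) * poch (+ 1 / 2) n) 2 n (begin
    fromℕ f * poch (fromℕ 2) n                       ≡⟨ cong (fromℕ f *_) (*-identityʳ (poch (fromℕ 2) n)) ⟨
    -- Here `1ℚ` stands for `fromℕ (1 !)`, and below for `fromℕ (D 0)`.
    fromℕ f * (poch (fromℕ 2) n * 1ℚ)                ≡⟨ cong (fromℕ f *_) (poch-! 1 n) ⟩
    fromℕ f * fromℕ ((n ℕ.+ 1) !)                    ≡⟨ fromℕ-* f ((n ℕ.+ 1) !) ⟨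
    fromℕ (f ℕ.* (n ℕ.+ 1) !)                        ≡⟨ cong (λ t → fromℕ (f ℕ.* t !)) (ℕ.+-comm n 1) ⟩
    fromℕ (f ℕ.* (suc n) !)                          ≡⟨ cong fromℕ (excess-0 n) ⟩
    fromℕ (D n)                                      ≡⟨ poch-D 0 n ⟨
    fromℕ (4 ^ n) * poch (+ 1 / 2) n * 1ℚ            ≡⟨ *-identityʳ (fromℕ (4 ^ n) * poch (+ 1 / 2) n) ⟩
    fromℕ (4 ^ n) * poch (+ 1 / 2) n                 ∎)
    where
    open ≡-Reasoning
    f = F (2 ℕ.* n) (+ 0) (+ n)

  closed-form-1 : ∀ n → fromℕ (F (2 ℕ.* n ℕ.+ 2) (+ 0) (+ n)) ≡
    fromℕ (2 ^ (2 ℕ.* n ℕ.+ 1) ℕ.* (n ℕ.+ 1)) * poch (+ 3 / 2) n ÷⟨ 3 ⟩ n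
  closed-form-1 n = with-coefficient 1 n f
    (trans (fromℕ-*-/ (4 ^ n) (2 ℕ.* (n ℕ.+ 1)) 1) (cong fromℕ power))
    (closed-form-/ 1 n f (2 ℕ.* (n ℕ.+ 1)) 1 (excess-1 n))
    where
    f = F (2 ℕ.* n ℕ.+ 2) (+ 0) (+ n)
    power : 4 ^ n ℕ.* (2 ℕ.* (n ℕ.+ 1)) ≡ 2 ^ (2 ℕ.* n ℕ.+ 1) ℕ.* (n ℕ.+ 1)
    power = trans (sym (ℕ.*-assoc (4 ^ n) 2 (n ℕ.+ 1)))
      (cong (ℕ._* (n ℕ.+ 1)) (trans (cong (ℕ._* 2) (ℕ.^-*-assoc 2 2 n)) (sym (ℕ.^-distribˡ-+-* 2 (2 ℕ.* n) 1))))

  closed-form-2 : ∀ n → fromℕ (F (2 ℕ.* n ℕ.+ 4) (+ 0) (+ n)) ≡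
    (+ (4 ^ n ℕ.* (n ℕ.+ 1) ℕ.* (8 ℕ.* n ^ 2 ℕ.+ 32 ℕ.* n ℕ.+ 33)) / 3) * poch (+ 3 / 2) n ÷⟨ 4 ⟩ n
  closed-form-2 n = with-coefficient 2 n f
    (trans (fromℕ-*-/ (4 ^ n) ((n ℕ.+ 1) ℕ.* p) 3) (cong (λ t → + t / 3) (sym (ℕ.*-assoc (4 ^ n) (n ℕ.+ 1) p))))
    (closed-form-/ 2 n f ((n ℕ.+ 1) ℕ.* p) 3 (excess-2 n))
    where
    f = F (2 ℕ.* n ℕ.+ 4) (+ 0) (+ n)
    p = 8 ℕ.* n ^ 2 ℕ.+ 32 ℕ.* n ℕ.+ 33

  closed-form-3 : ∀ n → fromℕ (F (2 ℕ.* n ℕ.+ 6) (+ 0) (+ n)) ≡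
    (+ (4 ^ n) / 4) * (+ ((n ℕ.+ 1) ℕ.* (64 ℕ.* n ^ 4 ℕ.+ 672 ℕ.* n ^ 3 ℕ.+ 2648 ℕ.* n ^ 2 ℕ.+ 4641 ℕ.* n ℕ.+ 3060)) / 9)
      * poch (+ 3 / 2) n ÷⟨ 5 ⟩ n
  closed-form-3 n = with-coefficient 3 n f
    (trans (fromℕ-*-/ (4 ^ n) N 36) (sym (/-*-/ (4 ^ n) N 4 9)))
    (closed-form-/ 3 n f N 36 (excess-3 n))
    where
    f = F (2 ℕ.* n ℕ.+ 6) (+ 0) (+ n)
    N = (n ℕ.+ 1) ℕ.* (64 ℕ.* n ^ 4 ℕ.+ 672 ℕ.* n ^ 3 ℕ.+ 2648 ℕ.* n ^ 2 ℕ.+ 4641 ℕ.* n ℕ.+ 3060)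

  closed-form-suc : ∀ k n → fromℕ (F (2 ℕ.* n ℕ.+ 2 ℕ.* suc k) (+ 0) (+ n)) ≡
    fromℕ (4 ^ n) * poch (+ 3 / 2) n ÷⟨ 3 ℕ.+ k ⟩ n * eval (gesselPoly k) (fromℕ n)
  closed-form-suc k n = closed-form (suc k) n (F (2 ℕ.* n ℕ.+ 2 ℕ.* suc k) (+ 0) (+ n)) (eval (gesselPoly k) (fromℕ n))
    (trans (cong (λ t → fromℕ t * fromℕ (2 ℕ.* (suc n ℕ.+ suc k) !)) (F-excess k n))
      (eval-gesselPoly (suc n) (fromℕ n) n+1≡ k))
    where
    n+1≡ : fromℕ n + 1ℚ ≡ fromℕ (suc n)
    n+1≡ = trans (+-comm (fromℕ n) 1ℚ) (sym (fromℕ-+ 1 n))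

  ratio : ℕ → ℕ → ℚ
  ratio zero    n = + 1 / suc (2 ℕ.* n)
  ratio (suc k) n = eval (gesselPoly k) (fromℕ n)

  closed-form-ratio : ∀ k n → fromℕ (F (2 ℕ.* n ℕ.+ 2 ℕ.* k) (+ 0) (+ n)) ≡
    fromℕ (4 ^ n) * poch (+ 3 / 2) n ÷⟨ 2 ℕ.+ k ⟩ n * ratio k n
  closed-form-ratio zero    n = begin
    fromℕ (F (2 ℕ.* n ℕ.+ 0) (+ 0) (+ n))
      ≡⟨ cong (λ m → fromℕ (F m (+ 0) (+ n))) (ℕ.+-identityʳ (2 ℕ.* n)) ⟩
    fromℕ (F (2 ℕ.* n) (+ 0) (+ n))
      ≡⟨ closed-form-0 n ⟩
    (+ (4 ^ n) / suc (2 ℕ.* n)) * T ÷⟨ 2 ⟩ n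
      ≡⟨ cong (λ t → t * T ÷⟨ 2 ⟩ n) (trans (fromℕ-*-/ (4 ^ n) 1 (suc (2 ℕ.* n)))
           (cong (λ t → + t / suc (2 ℕ.* n)) (ℕ.*-identityʳ (4 ^ n)))) ⟨
    fromℕ (4 ^ n) * z * T ÷⟨ 2 ⟩ n
      ≡⟨ cong (λ t → t ÷⟨ 2 ⟩ n) (swap (fromℕ (4 ^ n)) z T) ⟩
    fromℕ (4 ^ n) * T * z ÷⟨ 2 ⟩ n
      ≡⟨ ÷-*ʳ (fromℕ (4 ^ n) * T) z 2 n ⟨
    fromℕ (4 ^ n) * T ÷⟨ 2 ⟩ n * z ∎
    where
    open ≡-Reasoning
    T = poch (+ 3 / 2) n
    z = + 1 / suc (2 ℕ.* n)
    swap : ∀ x y z → x * y * z ≡ x * z * y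
    swap = solve-∀-in ℚ-ring
  closed-form-ratio (suc k) n = closed-form-suc k n

  ratio-polynomial : ∀ k → 1 ≤ k → Σ[ p ∈ Poly ]
    (∀ n → ratio k n ≡ eval p (fromℕ n)) × HasDegree p (2 ℕ.* k ℕ.∸ 1) × (X+1 ∣ₚ p)
  ratio-polynomial (suc k) _ =
    gesselPoly k , (λ _ → refl) , gesselPoly-degree k , X+1-∣ₚ (gesselPoly k) (gesselPoly-root k)

open import Data.Nat using (ℕ; suc; _+_; _*_; _^_; _∸_; _≤_)
open import Data.Integer using (+_)
open import Data.Rational using (ℚ; _/_) renaming (_*_ to _·_)
open import Data.Product using (_×_; _,_; Σ-syntax)
open import Relation.Binary.PropositionalEquality using (_≡_; refl; sym; trans)
open RationalFunctions

corollary4 :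
  (∀ (n : ℕ) →
    (fromℕ (F (2 * n) (+ 0) (+ n)) ≡ (+ (4 ^ n) / suc (2 * n)) · poch (+ 3 / 2) n ÷⟨ 2 ⟩ n)
    × ((+ (4 ^ n) / suc (2 * n)) · poch (+ 3 / 2) n ÷⟨ 2 ⟩ n ≡ fromℕ (4 ^ n) · poch (+ 1 / 2) n ÷⟨ 2 ⟩ n)
    × (fromℕ (F (2 * n + 2) (+ 0) (+ n)) ≡ fromℕ (2 ^ (2 * n + 1) * (n + 1)) · poch (+ 3 / 2) n ÷⟨ 3 ⟩ n)
    × (fromℕ (F (2 * n + 4) (+ 0) (+ n))
        ≡ (+ (4 ^ n * (n + 1) * (8 * n ^ 2 + 32 * n + 33)) / 3) · poch (+ 3 / 2) n ÷⟨ 4 ⟩ n)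
    -- 4ⁿ⁻¹ is written 4ⁿ / 4, since n = 0 is allowed
    × (fromℕ (F (2 * n + 6) (+ 0) (+ n))
        ≡ (+ (4 ^ n) / 4) · (+ ((n + 1) * (64 * n ^ 4 + 672 * n ^ 3 + 2648 * n ^ 2 + 4641 * n + 3060)) / 9)
          · poch (+ 3 / 2) n ÷⟨ 5 ⟩ n))
  × (∀ (k : ℕ) → Σ[ r ∈ (ℕ → ℚ) ]
      (∀ (n : ℕ) → fromℕ (F (2 * n + 2 * k) (+ 0) (+ n)) ≡ fromℕ (4 ^ n) · poch (+ 3 / 2) n ÷⟨ 2 + k ⟩ n · r n)
      × (k ≡ 0 → ∀ (n : ℕ) → r n ≡ + 1 / suc (2 * n))
      × (1 ≤ k → Σ[ p ∈ Poly ] (∀ (n : ℕ) → r n ≡ eval p (fromℕ n)) × HasDegree p (2 * k ∸ 1) × (X+1 ∣ₚ p)))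
corollary4 =
  (λ n → closed-form-0 n , trans (sym (closed-form-0 n)) (closed-form-0′ n)
       , closed-form-1 n , closed-form-2 n , closed-form-3 n)
  , λ k → ratio k , closed-form-ratio k , (λ { refl _ → refl }) , ratio-polynomial k
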